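{- For any (finite, simple) graphs $G$ and $H$, $$\lambda(G \times H) = \min\{2\lambda(G)|E(H)|,\ 2\lambda(H)|E(G)|,\ \delta(G \times H),\ \psi(G, H),\ \psi(H, G)\}.$$
   Context: The direct product $G\times H$ has vertex set $V(G)\times V(H)$, and $(x_1,y_1)$ is adjacent to $(x_2,y_2)$ if and only if $x_1x_2\in E(G)$ and $y_1y_2\in E(H)$. For a graph $F$, $\lambda(F)$ denotes the edge connectivity of $F$, i.e. the minimum size of a set $S\subseteq E(F)$ such that $F-S$ is disconnected (it is $0$ if $F$ is disconnected). $\delta(F)$ denotes the minimum degree of $F$. The bipartite edge frustration $\varphi(F)$ is the minimum number of edges whose deletion makes $F$ bipartite. For $A,B\subseteq V(F)$, $[A,B]$ denotes the set of edges with one endvertex in $A$ and the other in $B$, and $[A]$ denotes the subgraph of $F$ induced by $A$. Let $\mathcal{P}(V(F))$ be the set of all partitions $\{A,B\}$ of $V(F)$ into two subsets, one of which may be empty, and define $$\rho(F)=\min\{2\varphi([A])+|[A,B]| : \{A,B\}\in\mathcal{P}(V(F)),\ A\neq\emptyset\}.$$ For graphs $G,H$ define $\psi(G,H)=\rho(G)|E(H)|+2\varphi(H)|E(G)|$. -}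

module Defs where

open import Data.Nat using (ℕ; zero; suc; _+_; _*_; _≤_; _<ᵇ_; _⊔_; _⊓_)
open import Data.Bool using (Bool; true; false; _∧_; not; _xor_; T; if_then_else_)
open import Data.Bool.Properties using (∧-comm)
open import Data.Fin using (Fin; toℕ; remQuot)
open import Data.Product using (Σ; Σ-syntax; ∃; _×_; _,_; proj₁; proj₂)
open import Data.Sum using (_⊎_)
open import Relation.Nullary using (¬_)
open import Relation.Binary.PropositionalEquality using (_≡_; _≢_; refl; cong₂)

record Graph : Set where
  field
    n      : ℕ
    adj    : Fin n → Fin n → Bool
    sym    : ∀ i j → adj i j ≡ adj j i
    irrefl : ∀ i → adj i i ≡ false
open Graph public

cnt : ∀ {n} → (Fin n → Bool) → ℕ
cnt {zero}  p = 0
cnt {suc n} p = (if p Fin.zero then 1 else 0) + cnt (λ i → p (Fin.suc i))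
  where import Data.Fin as Fin

sumFin : ∀ {n} → (Fin n → ℕ) → ℕ
sumFin {zero}  f = 0
sumFin {suc n} f = f Fin.zero + sumFin (λ i → f (Fin.suc i))
  where import Data.Fin as Fin

pairCount : ∀ {n} → (Fin n → Fin n → Bool) → ℕ
pairCount R = sumFin (λ i → cnt (λ j → (toℕ i <ᵇ toℕ j) ∧ R i j))

∣E∣ : Graph → ℕ
∣E∣ G = pairCount (adj G)

deg : (G : Graph) → Fin (n G) → ℕ
deg G v = cnt (adj G v)

IsMin : (ℕ → Set) → ℕ → Set
IsMin P k = P k × (∀ m → P m → k ≤ m)

MinDegree : Graph → ℕ → Set
MinDegree G = IsMin (λ d → Σ[ v ∈ Fin (n G) ] deg G v ≡ d)

record EdgeSet (G : Graph) : Set where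
  field
    S    : Fin (n G) → Fin (n G) → Bool
    sub  : ∀ i j → T (S i j) → T (adj G i j)
    ssym : ∀ i j → S i j ≡ S j i
open EdgeSet public

∣_∣ₑ : ∀ {G} → EdgeSet G → ℕ
∣ X ∣ₑ = pairCount (S X)

data Reach {n : ℕ} (R : Fin n → Fin n → Bool) : Fin n → Fin n → Set where
  here : ∀ {i} → Reach R i i
  step : ∀ {i j k} → T (R i j) → Reach R j k → Reach R i k

Connected : ∀ {n} → (Fin n → Fin n → Bool) → Set
Connected {n} R = ∀ (i j : Fin n) → Reach R i j

_∖ₑ_ : (G : Graph) → EdgeSet G → Fin (n G) → Fin (n G) → Bool
(G ∖ₑ X) i j = adj G i j ∧ not (S X i j)

-- λ(G) = k : least size of an edge set X with G − X disconnected.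
-- Convention: for a one-vertex graph (no disconnecting set exists) λ = 0,
-- realised by allowing X (necessarily empty) when n G ≤ 1.
EdgeConnectivity : Graph → ℕ → Set
EdgeConnectivity G = IsMin (λ k → Σ[ X ∈ EdgeSet G ]
  (∣ X ∣ₑ ≡ k × ((¬ Connected (G ∖ₑ X)) ⊎ n G ≤ 1)))

-- φ([A]) = f, for A ⊆ V(G) given by a Boolean predicate. An edge set of [A]
-- is an edge set of G all of whose edges lie inside A; [A] − X is bipartite
-- iff there is a 2-colouring of A with every remaining edge of [A]
-- bichromatic.
FrustrationOn : (G : Graph) → (Fin (n G) → Bool) → ℕ → Set
FrustrationOn G A = IsMin (λ k → Σ[ X ∈ EdgeSet G ]
  ((∀ i j → T (S X i j) → T (A i ∧ A j)) ×
   ∣ X ∣ₑ ≡ k ×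
   Σ[ c ∈ (Fin (n G) → Bool) ]
     (∀ i j → T (A i ∧ A j ∧ adj G i j ∧ not (S X i j)) → c i ≢ c j)))

Frustration : Graph → ℕ → Set
Frustration G = FrustrationOn G (λ _ → true)

crossEdges : (G : Graph) → (Fin (n G) → Bool) → ℕ
crossEdges G A = pairCount (λ i j → adj G i j ∧ (A i xor A j))

Rho : Graph → ℕ → Set
Rho G = IsMin (λ r → Σ[ A ∈ (Fin (n G) → Bool) ]
  ((Σ[ v ∈ Fin (n G) ] T (A v)) ×
   Σ[ f ∈ ℕ ] (FrustrationOn G A f × r ≡ 2 * f + crossEdges G A)))

ψ : (G H : Graph) → (ρG φH : ℕ) → ℕ
ψ G H ρG φH = ρG * ∣E∣ H + 2 * φH * ∣E∣ G

fstV : (G H : Graph) → Fin (n G * n H) → Fin (n G)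
fstV G H p = proj₁ (remQuot {n G} (n H) p)

sndV : (G H : Graph) → Fin (n G * n H) → Fin (n H)
sndV G H p = proj₂ (remQuot {n G} (n H) p)

pAdj : (G H : Graph) → Fin (n G * n H) → Fin (n G * n H) → Bool
pAdj G H p q = adj G (fstV G H p) (fstV G H q) ∧ adj H (sndV G H p) (sndV G H q)

pSym : ∀ G H p q → pAdj G H p q ≡ pAdj G H q p
pSym G H p q = cong₂ _∧_ (sym G (fstV G H p) (fstV G H q)) (sym H (sndV G H p) (sndV G H q))

pIrr : ∀ G H p → pAdj G H p p ≡ false
pIrr G H p rewrite irrefl G (fstV G H p) = refl

_×ᵍ_ : Graph → Graph → Graph
G ×ᵍ H = record
  { n = n G * n H ; adj = pAdj G H ; sym = pSym G H ; irrefl = pIrr G H }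

-- A cut of G × H is a two-colouring F of V(G) × V(H); the number of edges it
-- cuts over an edge gg′ of G depends only on the rows F g and F g′ (on the
-- columns F h and F h′, over an edge hh′ of H). Two rows that differ somewhere
-- cost at least ρ(H), and two equal nonconstant rows at least 2λ(H). This gives
-- the terms with λ when all columns, or all rows, are constant, and the terms
-- with ψ when no column is constant and H is bipartite, or dually. In every
-- other case two adjacent nonconstant rows cost at least 1, and they cost
-- exactly 1 only if they differ in at least 2δ(H) places, each of them in a
-- nonconstant column. Let M and N be the sets of nonconstant rows and columns.
-- If adjacent rows in M cost at least κ ≤ 2, the cut has at least κ δ(G) |M| / 2
-- edges, and it has at least δ(G)δ(H) edges unless |M| ≥ δ(G); dually for N.
-- Having κ = 1 instead of 2 on one side doubles the bound on the other, so the
-- two estimates multiply to cut² ≥ δ(G)² δ(H)².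
module Submission where

open import Defs
open import Data.Nat using (ℕ; zero; suc; _+_; _*_; _∸_; _≤_; _<_; _⊓_; _<ᵇ_; z≤n; s≤s; _≤?_; _≟_; >-nonZero)
open import Data.Nat.Properties using (≤-refl; ≤-reflexive; ≤-trans; ≤-antisym; ≤-total; ≤-pred; <⇒≱; n≤1+n; ≰⇒>; ≮⇒≥; m≤m+n; m≤n+m; n≤0⇒n≡0; +-comm; +-assoc; +-identityʳ; +-mono-≤; +-monoʳ-≤; +-monoˡ-≤; *-comm; *-assoc; *-zeroʳ; *-identityʳ; *-distribˡ-+; *-mono-≤; *-monoʳ-≤; *-monoˡ-≤; *-cancelˡ-≤; *-cancelʳ-≤; m≤n+o⇒m∸n≤o; m+[n∸m]≡n; m≤m*n; m<n⇒0<n∸m; ⊓-glb; m⊓n≤m; m⊓n≤n; module ≤-Reasoning)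
open import Data.Nat.Tactic.RingSolver using (solve-∀)
open import Data.Bool using (Bool; true; false; _∧_; _∨_; not; _xor_; T; if_then_else_) renaming (_≟_ to _≟ᵇ_)
open import Data.Fin using (Fin; zero; suc; toℕ; remQuot; combine; splitAt)
open import Data.Fin.Properties using (any?; sequence; remQuot-combine; combine-remQuot) renaming (_≟_ to _≟ꟳ_)
open import Data.Product using (Σ-syntax; ∃-syntax; _×_; _,_; proj₁; proj₂)
open import Data.Sum using (_⊎_; inj₁; inj₂; [_,_]′; map₁)
open import Data.Bool.Properties using (T-∧; T-≡; ∧-comm; xor-comm; xor-same)
open import Effect.Monad using (RawMonad)
open import Data.Unit using (tt)
open import Data.Empty using (⊥-elim)
open import Function using (_∘_; flip; Equivalence)
open import Relation.Nullary using (¬_; Dec; yes; no; does; contradiction)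
open import Relation.Nullary.Negation using (¬¬-Monad)
open import Relation.Nullary.Decidable using (toWitness; ¬?; _×-dec_; _⊎-dec_; _→-dec_; decidable-stable; dec-true; dec-false; ¬¬-excluded-middle)
open import Relation.Binary.PropositionalEquality using (_≡_; _≢_; refl; trans; cong; cong₂; subst; module ≡-Reasoning) renaming (sym to ≡-sym)

-- Boolean indicators and finite sums.

⟦_⟧ : Bool → ℕ
⟦ b ⟧ = if b then 1 else 0

-- Makes statements quantified over Booleans decidable, so that pointwise inequalities between
-- indicators are settled by truth table through `toWitness`.
∀-Bool? : {P : Bool → Set} → (∀ b → Dec (P b)) → Dec (∀ b → P b)
∀-Bool? P? with P? true | P? false
... | yes t | yes f = yes λ { true → t ; false → f }
... | no ¬t | _     = no λ h → ¬t (h true)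
... | _     | no ¬f = no λ h → ¬f (h false)

sum-cong : ∀ {k} {f g : Fin k → ℕ} → (∀ i → f i ≡ g i) → sumFin f ≡ sumFin g
sum-cong {zero}  h = refl
sum-cong {suc k} h = cong₂ _+_ (h zero) (sum-cong (h ∘ suc))

sum-mono : ∀ {k} {f g : Fin k → ℕ} → (∀ i → f i ≤ g i) → sumFin f ≤ sumFin g
sum-mono {zero}  h = z≤n
sum-mono {suc k} h = +-mono-≤ (h zero) (sum-mono (h ∘ suc))

+-interchange : ∀ a b c d → (a + b) + (c + d) ≡ (a + c) + (b + d)
+-interchange = solve-∀

sum-+ : ∀ {k} (f g : Fin k → ℕ) → sumFin (λ i → f i + g i) ≡ sumFin f + sumFin g
sum-+ {zero}  f g = refl
sum-+ {suc k} f g = trans (cong (f zero + g zero +_) (sum-+ (f ∘ suc) (g ∘ suc)))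
                          (+-interchange (f zero) (g zero) _ _)

sum-* : ∀ {k} c (f : Fin k → ℕ) → sumFin (λ i → c * f i) ≡ c * sumFin f
sum-* {zero}  c f = ≡-sym (*-zeroʳ c)
sum-* {suc k} c f = trans (cong (c * f zero +_) (sum-* c (f ∘ suc)))
                          (≡-sym (*-distribˡ-+ c (f zero) _))

sum-0 : ∀ k → sumFin {k} (λ _ → 0) ≡ 0
sum-0 zero    = refl
sum-0 (suc k) = sum-0 k

sum-swap : ∀ {k l} (f : Fin k → Fin l → ℕ) →
           sumFin (λ i → sumFin (f i)) ≡ sumFin (λ j → sumFin (λ i → f i j))
sum-swap {zero}  {l} f = ≡-sym (sum-0 l)
sum-swap {suc k} {l} f = trans (cong (sumFin (f zero) +_) (sum-swap (f ∘ suc)))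
                               (≡-sym (sum-+ (f zero) _))

term≤sum : ∀ {k} (f : Fin k → ℕ) i → f i ≤ sumFin f
term≤sum f zero    = m≤m+n _ _
term≤sum f (suc i) = ≤-trans (term≤sum (f ∘ suc) i) (m≤n+m _ _)

sum-splitAt : ∀ k {l} (f : Fin k ⊎ Fin l → ℕ) →
  sumFin (λ p → f (splitAt k p)) ≡ sumFin (f ∘ inj₁) + sumFin (f ∘ inj₂)
sum-splitAt zero    f = refl
sum-splitAt (suc k) {l} f = begin
  f (inj₁ zero) + sumFin (λ p → f (splitAt (suc k) (suc p)))
    ≡⟨ cong (f (inj₁ zero) +_) (sum-splitAt k (f ∘ map₁ suc)) ⟩
  f (inj₁ zero) + (sumFin (f ∘ inj₁ ∘ suc) + sumFin (f ∘ inj₂))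
    ≡⟨ ≡-sym (+-assoc (f (inj₁ zero)) _ _) ⟩
  f (inj₁ zero) + sumFin (f ∘ inj₁ ∘ suc) + sumFin (f ∘ inj₂) ∎
  where open ≡-Reasoning

sum-remQuot : ∀ {k} l (f : Fin k × Fin l → ℕ) →
  sumFin (λ p → f (remQuot {k} l p)) ≡ sumFin (λ i → sumFin (λ j → f (i , j)))
sum-remQuot {zero}  l f = refl
sum-remQuot {suc k} l f =
  trans (sum-cong by-block)
 (trans (sum-splitAt l (f ∘ split))
        (cong (sumFin (λ j → f (zero , j)) +_) (sum-remQuot {k} l (λ { (i , j) → f (suc i , j) }))))
  where
    split : Fin l ⊎ Fin (k * l) → Fin (suc k) × Fin l
    split (inj₁ j) = zero , j
    split (inj₂ q) = suc (proj₁ (remQuot {k} l q)) , proj₂ (remQuot {k} l q)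
    by-block : ∀ p → f (remQuot {suc k} l p) ≡ f (split (splitAt l p))
    by-block p with splitAt l p
    ... | inj₁ j = refl
    ... | inj₂ q = refl

-- Double sums.

∑∑ : ∀ {k l} → (Fin k → Fin l → ℕ) → ℕ
∑∑ f = sumFin (λ i → sumFin (f i))

module _ {k l : ℕ} where

  ∑∑-cong : {f g : Fin k → Fin l → ℕ} → (∀ i j → f i j ≡ g i j) → ∑∑ f ≡ ∑∑ g
  ∑∑-cong h = sum-cong (λ i → sum-cong (h i))

  ∑∑-mono : {f g : Fin k → Fin l → ℕ} → (∀ i j → f i j ≤ g i j) → ∑∑ f ≤ ∑∑ g
  ∑∑-mono h = sum-mono (λ i → sum-mono (h i))

  ∑∑-+ : (f g : Fin k → Fin l → ℕ) → ∑∑ (λ i j → f i j + g i j) ≡ ∑∑ f + ∑∑ g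
  ∑∑-+ f g = trans (sum-cong (λ i → sum-+ (f i) (g i))) (sum-+ (sumFin ∘ f) (sumFin ∘ g))

  ∑∑-* : ∀ c (f : Fin k → Fin l → ℕ) → ∑∑ (λ i j → c * f i j) ≡ c * ∑∑ f
  ∑∑-* c f = trans (sum-cong (λ i → sum-* c (f i))) (sum-* c (sumFin ∘ f))

  ∑∑-*ʳ : ∀ (f : Fin k → Fin l → ℕ) c → ∑∑ (λ i j → f i j * c) ≡ ∑∑ f * c
  ∑∑-*ʳ f c = trans (∑∑-cong (λ i j → *-comm (f i j) c)) (trans (∑∑-* c f) (*-comm c _))

  sum-∑∑-swap : ∀ {m} (f : Fin m → Fin k → Fin l → ℕ) →
                sumFin (λ a → ∑∑ (f a)) ≡ ∑∑ (λ i j → sumFin (λ a → f a i j))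
  sum-∑∑-swap f = trans (sum-swap (λ a i → sumFin (f a i))) (sum-cong (λ i → sum-swap (λ a → f a i)))

∑∑-swap : ∀ {k l m o} (f : Fin k → Fin l → Fin m → Fin o → ℕ) →
  ∑∑ (λ i j → ∑∑ (f i j)) ≡ ∑∑ (λ a b → ∑∑ (λ i j → f i j a b))
∑∑-swap f = trans (sum-cong (λ i → sum-∑∑-swap (f i)))
                  (sum-∑∑-swap (λ i a b → sumFin (λ j → f i j a b)))

∑∑-product : ∀ {k l m o} (f : Fin k → Fin l → ℕ) (g : Fin m → Fin o → ℕ) →
  ∑∑ (λ i j → ∑∑ (λ a b → f i j * g a b)) ≡ ∑∑ f * ∑∑ g
∑∑-product f g = trans (∑∑-cong (λ i j → ∑∑-* (f i j) g)) (∑∑-*ʳ f (∑∑ g))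

-- Counting predicates and pairs.

cnt≡sum : ∀ {k} (p : Fin k → Bool) → cnt p ≡ sumFin (λ i → ⟦ p i ⟧)
cnt≡sum {zero}  p = refl
cnt≡sum {suc k} p = cong (⟦ p zero ⟧ +_) (cnt≡sum (p ∘ suc))

<ᵇ-split : ∀ {k} (R : Fin k → Fin k → Bool) → (∀ i → R i i ≡ false) → ∀ i j →
  ⟦ R i j ⟧ ≡ ⟦ (toℕ i <ᵇ toℕ j) ∧ R i j ⟧ + ⟦ (toℕ j <ᵇ toℕ i) ∧ R i j ⟧
<ᵇ-split R irr zero    zero    rewrite irr zero = refl
<ᵇ-split R irr zero    (suc j) = ≡-sym (+-identityʳ _)
<ᵇ-split R irr (suc i) zero    = refl
<ᵇ-split R irr (suc i) (suc j) = <ᵇ-split (λ a b → R (suc a) (suc b)) (irr ∘ suc) i j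

-- Every unordered pair appears in both orders and the diagonal is empty. All later sums run over
-- ordered pairs, which is the source of the factors 2 in front of edge counts.
∑∑-pairCount : ∀ {k} (R : Fin k → Fin k → Bool) →
  (∀ i j → R i j ≡ R j i) → (∀ i → R i i ≡ false) →
  ∑∑ (λ i j → ⟦ R i j ⟧) ≡ 2 * pairCount R
∑∑-pairCount {k} R sm irr = begin
  ∑∑ (λ i j → ⟦ R i j ⟧)            ≡⟨ ∑∑-cong (<ᵇ-split R irr) ⟩
  ∑∑ (λ i j → up i j + dn i j)      ≡⟨ ∑∑-+ up dn ⟩
  ∑∑ up + ∑∑ dn                     ≡⟨ cong (∑∑ up +_) (trans (sum-swap dn) (∑∑-cong dn≡up)) ⟩
  ∑∑ up + ∑∑ up                     ≡⟨ cong (λ x → x + x) (≡-sym (sum-cong (λ i → cnt≡sum (λ j → (toℕ i <ᵇ toℕ j) ∧ R i j)))) ⟩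
  pairCount R + pairCount R         ≡⟨ cong (pairCount R +_) (≡-sym (+-identityʳ _)) ⟩
  2 * pairCount R                   ∎
  where
    open ≡-Reasoning
    up dn : Fin k → Fin k → ℕ
    up i j = ⟦ (toℕ i <ᵇ toℕ j) ∧ R i j ⟧
    dn i j = ⟦ (toℕ j <ᵇ toℕ i) ∧ R i j ⟧
    dn≡up : ∀ i j → dn j i ≡ up i j
    dn≡up i j = cong (λ b → ⟦ (toℕ i <ᵇ toℕ j) ∧ b ⟧) (sm j i)

sum-pos : ∀ {k} (f : Fin k → ℕ) → 1 ≤ sumFin f → ∃[ i ] 1 ≤ f i
sum-pos {suc k} f p with f zero in eq
... | suc m = zero , subst (1 ≤_) (≡-sym eq) (s≤s z≤n)
... | zero with sum-pos (f ∘ suc) p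
...   | i , q = suc i , q

two-terms≤sum : ∀ {k} (f : Fin k → ℕ) {i j} → i ≢ j → f i + f j ≤ sumFin f
two-terms≤sum f {zero}  {zero}  i≢j = ⊥-elim (i≢j refl)
two-terms≤sum f {zero}  {suc j} i≢j = +-monoʳ-≤ (f zero) (term≤sum (f ∘ suc) j)
two-terms≤sum f {suc i} {zero}  i≢j =
  subst (_≤ sumFin f) (+-comm (f zero) (f (suc i))) (+-monoʳ-≤ (f zero) (term≤sum (f ∘ suc) i))
two-terms≤sum f {suc i} {suc j} i≢j =
  ≤-trans (two-terms≤sum (f ∘ suc) (i≢j ∘ cong suc)) (m≤n+m _ _)

-- Two different positive positions, in different rows or in the same row, would already sum to 2.
∑∑≤1-unique : ∀ {k l} (f : Fin k → Fin l → ℕ) → ∑∑ f ≤ 1 → ∀ {i j i′ j′} →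
  1 ≤ f i j → 1 ≤ f i′ j′ → i ≡ i′ × j ≡ j′
∑∑≤1-unique f le {i} {j} {i′} {j′} p q with i ≟ꟳ i′
... | no i≢i′ = contradiction
      (≤-trans (+-mono-≤ (≤-trans p (term≤sum (f i) j)) (≤-trans q (term≤sum (f i′) j′)))
               (≤-trans (two-terms≤sum (sumFin ∘ f) i≢i′) le))
      λ { (s≤s ()) }
... | yes refl with j ≟ꟳ j′
...   | yes j≡j′ = refl , j≡j′
...   | no j≢j′ = contradiction
      (≤-trans (+-mono-≤ p q)
        (≤-trans (two-terms≤sum (f i) j≢j′) (≤-trans (term≤sum (sumFin ∘ f) i) le)))
      λ { (s≤s ()) }

sum-indicator : ∀ {k} (v : Fin k) (f : Fin k → ℕ) → sumFin (λ i → ⟦ does (i ≟ꟳ v) ⟧ * f i) ≡ f v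
sum-indicator {suc k} zero f = trans (cong (f zero + 0 +_) (sum-0 k))
                                (trans (+-identityʳ _) (+-identityʳ _))
sum-indicator {suc k} (suc v) f = sum-indicator v (f ∘ suc)

cnt-mono : ∀ {k} {p q : Fin k → Bool} → (∀ i → p i ≡ true → q i ≡ true) → cnt p ≤ cnt q
cnt-mono {p = p} {q} h rewrite cnt≡sum p | cnt≡sum q = sum-mono pointwise
  where
    pointwise : ∀ i → ⟦ p i ⟧ ≤ ⟦ q i ⟧
    pointwise i with p i | h i
    ... | false | _ = z≤n
    ... | true  | t rewrite t refl = ≤-refl

cnt-pos : ∀ {k} (p : Fin k → Bool) {i} → p i ≡ true → 1 ≤ cnt p
cnt-pos p {i} pi = subst (_ ≤_) (≡-sym (cnt≡sum p))
  (≤-trans (≤-reflexive (cong ⟦_⟧ (≡-sym pi))) (term≤sum (⟦_⟧ ∘ p) i))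

-- The indicator of `v` is disjoint from `p`, and together they still fit under `q`.
cnt-mono-< : ∀ {k} {p q : Fin k → Bool} → (∀ i → p i ≡ true → q i ≡ true) →
  ∀ {v} → p v ≡ false → q v ≡ true → cnt p < cnt q
cnt-mono-< {p = p} {q} h {v} pv qv = begin
  suc (cnt p)                                             ≡⟨ cong suc (cnt≡sum p) ⟩
  1 + sumFin (⟦_⟧ ∘ p)                                    ≡⟨ cong (_+ sumFin (⟦_⟧ ∘ p)) (sum-indicator v (λ _ → 1)) ⟨
  sumFin (λ i → ⟦ does (i ≟ꟳ v) ⟧ * 1) + sumFin (⟦_⟧ ∘ p) ≡⟨ sum-+ _ (⟦_⟧ ∘ p) ⟨
  sumFin (λ i → ⟦ does (i ≟ꟳ v) ⟧ * 1 + ⟦ p i ⟧)          ≤⟨ sum-mono pointwise ⟩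
  sumFin (⟦_⟧ ∘ q)                                        ≡⟨ cnt≡sum q ⟨
  cnt q                                                   ∎
  where
    open ≤-Reasoning
    pointwise : ∀ i → ⟦ does (i ≟ꟳ v) ⟧ * 1 + ⟦ p i ⟧ ≤ ⟦ q i ⟧
    pointwise i with i ≟ꟳ v
    ... | yes refl rewrite pv | qv = ≤-refl
    ... | no _ with p i | h i
    ...   | false | _ = z≤n
    ...   | true  | t rewrite t refl = ≤-refl

cnt-two : ∀ {k} (p : Fin k → Bool) → 2 ≤ cnt p → ∃[ i ] ∃[ j ] (i ≢ j × p i ≡ true × p j ≡ true)
cnt-two p two with any? (λ i → any? (λ j → ¬? (i ≟ꟳ j) ×-dec (p i ≟ᵇ true) ×-dec (p j ≟ᵇ true)))
... | yes w = w
... | no none = contradiction two (<⇒≱ cnt<2)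
  where
    open ≤-Reasoning
    first : ∃[ i ] 1 ≤ ⟦ p i ⟧
    first = sum-pos (⟦_⟧ ∘ p) (subst (1 ≤_) (cnt≡sum p) (≤-trans (s≤s z≤n) two))
    v : _
    v = proj₁ first
    ⟦⟧-pos : ∀ {b} → 1 ≤ ⟦ b ⟧ → b ≡ true
    ⟦⟧-pos {true} _ = refl
    pointwise : ∀ i → ⟦ p i ⟧ ≤ ⟦ does (i ≟ꟳ v) ⟧ * 1
    pointwise i with i ≟ꟳ v | p i in eq
    ... | yes _   | true  = ≤-refl
    ... | yes _   | false = z≤n
    ... | no _    | false = z≤n
    ... | no i≢v  | true  = ⊥-elim (none (i , v , i≢v , eq , ⟦⟧-pos (proj₂ first)))
    cnt<2 : cnt p < 2
    cnt<2 = s≤s (begin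
      cnt p                                  ≡⟨ cnt≡sum p ⟩
      sumFin (⟦_⟧ ∘ p)                       ≤⟨ sum-mono pointwise ⟩
      sumFin (λ i → ⟦ does (i ≟ꟳ v) ⟧ * 1)   ≡⟨ sum-indicator v (λ _ → 1) ⟩
      1                                      ∎)

-- Cut costs in one factor and edge connectivity.

wt : (G : Graph) → Fin (n G) → Fin (n G) → ℕ
wt G i j = ⟦ adj G i j ⟧

-- If `P` and `Q` colour the two copies of `G` over an edge of the other factor, the product edges
-- over that edge are the ordered adjacent pairs of `G`, so this counts the cut ones exactly. For
-- `P` equal to `Q` it is twice the size of the cut of `G`.
cost : (G : Graph) → (P Q : Fin (n G) → Bool) → ℕ
cost G P Q = ∑∑ (λ i j → wt G i j * ⟦ P i xor Q j ⟧)

⟦∧⟧ : ∀ a b → ⟦ a ∧ b ⟧ ≡ ⟦ a ⟧ * ⟦ b ⟧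
⟦∧⟧ true  b = ≡-sym (+-identityʳ _)
⟦∧⟧ false b = refl

module _ (G : Graph) where

  private
    V : Set
    V = Fin (n G)

  wt-sym : ∀ i j → wt G i j ≡ wt G j i
  wt-sym i j = cong ⟦_⟧ (sym G i j)

  ∑∑-wt : ∑∑ (wt G) ≡ 2 * ∣E∣ G
  ∑∑-wt = ∑∑-pairCount (adj G) (sym G) (irrefl G)

  deg≡sum : ∀ v → deg G v ≡ sumFin (wt G v)
  deg≡sum v = cnt≡sum (adj G v)

  ∑∑-subset : (R : V → V → Bool) → (∀ i j → R i j ≡ R j i) → (∀ i j → T (R i j) → T (adj G i j)) →
    ∑∑ (λ i j → ⟦ R i j ⟧) ≡ 2 * pairCount R
  ∑∑-subset R sm sb = ∑∑-pairCount R sm irr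
    where
      irr : ∀ i → R i i ≡ false
      irr i with R i i | sb i i
      ... | false | _ = refl
      ... | true  | t = ⊥-elim (subst T (irrefl G i) (t tt))

  ∑∑-edgeSet : (X : EdgeSet G) → ∑∑ (λ i j → ⟦ S X i j ⟧) ≡ 2 * ∣ X ∣ₑ
  ∑∑-edgeSet X = ∑∑-subset (S X) (ssym X) (sub X)

  module _ (P Q : V → Bool) where

    cost-sym : cost G P Q ≡ cost G Q P
    cost-sym = trans (sum-swap (λ i j → wt G i j * ⟦ P i xor Q j ⟧))
      (∑∑-cong (λ i j → cong₂ (λ x y → x * ⟦ y ⟧) (wt-sym j i) (xor-comm (P j) (Q i))))

    -- The summand on the left no longer depends on the orientation of the edge, so bounds on `cost`
    -- can be checked edge by edge, by truth table.
    cost-double : ∑∑ (λ i j → wt G i j * (⟦ P i xor Q j ⟧ + ⟦ P j xor Q i ⟧)) ≡ 2 * cost G P Q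
    cost-double = begin
      ∑∑ (λ i j → wt G i j * (⟦ P i xor Q j ⟧ + ⟦ P j xor Q i ⟧))
        ≡⟨ ∑∑-cong (λ i j → *-distribˡ-+ (wt G i j) ⟦ P i xor Q j ⟧ _) ⟩
      ∑∑ (λ i j → wt G i j * ⟦ P i xor Q j ⟧ + wt G i j * ⟦ P j xor Q i ⟧)
        ≡⟨ ∑∑-+ {n G} {n G} _ _ ⟩
      cost G P Q + ∑∑ (λ i j → wt G i j * ⟦ P j xor Q i ⟧)
        ≡⟨ cong (cost G P Q +_) (trans (sum-swap (λ i j → wt G i j * ⟦ P j xor Q i ⟧)) (∑∑-cong (λ i j → cong (_* ⟦ P i xor Q j ⟧) (wt-sym j i)))) ⟩
      cost G P Q + cost G P Q
        ≡⟨ cong (cost G P Q +_) (≡-sym (+-identityʳ _)) ⟩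
      2 * cost G P Q ∎
      where open ≡-Reasoning

  cost-crossEdges : (A : V → Bool) → cost G A A ≡ 2 * crossEdges G A
  cost-crossEdges A = trans
    (∑∑-cong (λ i j → ≡-sym (⟦∧⟧ (adj G i j) (A i xor A j))))
    (∑∑-subset _ (λ i j → cong₂ _∧_ (sym G i j) (xor-comm (A i) (A j)))
                 (λ i j → proj₁ ∘ Equivalence.to T-∧))

  ∅ₑ : EdgeSet G
  ∅ₑ = record { S = λ _ _ → false ; sub = λ _ _ () ; ssym = λ _ _ → refl }

  ∣∅ₑ∣≡0 : ∣ ∅ₑ ∣ₑ ≡ 0
  ∣∅ₑ∣≡0 = trans (sum-cong {n G} (λ i → trans (cnt≡sum {n G} (λ j → (toℕ i <ᵇ toℕ j) ∧ false))
                   (trans (sum-cong {n G} (λ j → vanish (toℕ i <ᵇ toℕ j))) (sum-0 (n G)))))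
                 (sum-0 (n G))
    where
      vanish : ∀ b → ⟦ b ∧ false ⟧ ≡ 0
      vanish true  = refl
      vanish false = refl

  λ-trivial : ∀ {l} → EdgeConnectivity G l → n G ≤ 1 → l ≡ 0
  λ-trivial conn n≤1 = n≤0⇒n≡0 (proj₂ conn 0 (∅ₑ , ∣∅ₑ∣≡0 , inj₂ n≤1))

  crossSet : (V → Bool) → EdgeSet G
  crossSet A = record
    { S    = λ i j → adj G i j ∧ (A i xor A j)
    ; sub  = λ i j → proj₁ ∘ Equivalence.to T-∧
    ; ssym = λ i j → cong₂ _∧_ (sym G i j) (xor-comm (A i) (A j))
    }

  -- After deleting the edges between `A` and its complement, `A` is constant along every path, so
  -- `u` and `v` are separated.
  λ≤cost : ∀ {l} → EdgeConnectivity G l → (A : V → Bool) → ∀ {u v} → A u ≡ true → A v ≡ false →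
    2 * l ≤ cost G A A
  λ≤cost conn A {u} {v} Au Av = subst (_ ≤_) (≡-sym (cost-crossEdges A))
    (*-monoʳ-≤ 2 (proj₂ conn _ (crossSet A , refl , inj₁ split)))
    where
      same-side : ∀ {i j} → Reach (G ∖ₑ crossSet A) i j → A i ≡ A j
      same-side here = refl
      same-side (step {i} {j} r rs) = trans (edge (adj G i j) (A i) (A j) r) (same-side rs)
        where
          edge : ∀ a p q → T (a ∧ not (a ∧ (p xor q))) → p ≡ q
          edge true true  true  _ = refl
          edge true false false _ = refl
      split : ¬ Connected (G ∖ₑ crossSet A)
      split c with trans (≡-sym Au) (trans (same-side (c u v)) Av)
      ... | ()

  -- `A` is the set reachable from `u`. A surviving edge cannot leave it, so every edge cut by `A`
  -- lies in `X`. Reachability is not decided here, whence the double negation; it is removed later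
  -- because the goals are decidable inequalities.
  disconnected⇒cut : (X : EdgeSet G) → ¬ Connected (G ∖ₑ X) →
    ¬ ¬ (Σ[ A ∈ (V → Bool) ] ∃[ u ] ∃[ v ] (A u ≡ true × A v ≡ false × cost G A A ≤ 2 * ∣ X ∣ₑ))
  disconnected⇒cut X disc none = seq (λ u → seq (λ v ¬r → coloured u v ¬r)) disc
    where
      R = G ∖ₑ X
      -- Double negation commutes with quantification over a finite set.
      seq : {k : ℕ} {P : Fin k → Set} → (∀ i → ¬ ¬ P i) → ¬ ¬ (∀ i → P i)
      seq = sequence (RawMonad.rawApplicative ¬¬-Monad)
      snoc : ∀ {i j k} → Reach R i j → T (R j k) → Reach R i k
      snoc here        e = step e here
      snoc (step r rs) e = step r (snoc rs e)
      coloured : ∀ u v → ¬ ¬ Reach R u v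
      coloured u v ¬r = seq (λ w → ¬¬-excluded-middle {A = Reach R u w}) λ reach? →
        none ((does ∘ reach?) , u , v , dec-true (reach? u) here , dec-false (reach? v) ¬r ,
          subst (cost G (does ∘ reach?) (does ∘ reach?) ≤_) (∑∑-edgeSet X) (∑∑-mono (bound reach?)))
        where
          bound : (reach? : ∀ w → Dec (Reach R u w)) → ∀ i j →
            wt G i j * ⟦ does (reach? i) xor does (reach? j) ⟧ ≤ ⟦ S X i j ⟧
          bound reach? i j with adj G i j in a | S X i j in x | reach? i | reach? j
          ... | false | _     | _     | _     = z≤n
          ... | true  | true  | p     | q     = toWitness {a? = ∀-Bool? λ b → ∀-Bool? λ c → (⟦ b xor c ⟧ + 0) ≤? 1} tt (does p) (does q)
          ... | true  | false | yes _ | yes _ = z≤n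
          ... | true  | false | no _  | no _  = z≤n
          ... | true  | false | yes p | no ¬q = ⊥-elim (¬q (snoc p (subst T (≡-sym (cong₂ (λ s t → s ∧ not t) a x)) tt)))
          ... | true  | false | no ¬p | yes q = ⊥-elim (¬p (snoc q (subst T (≡-sym (cong₂ (λ s t → s ∧ not t) (trans (sym G j i) a) (trans (ssym X j i) x))) tt)))

-- For an undecided `P` the least witness exists only up to double negation; descent below `k`
-- refutes its absence.
IsMin-exists : {P : ℕ → Set} → ∀ {k} → P k → ¬ ¬ (∃[ m ] IsMin P m)
IsMin-exists {P} {k} pk none = below (suc k) k ≤-refl pk
  where
    below : ∀ b m → m < b → ¬ P m
    below (suc b) m (s≤s m≤b) pm =
      none (m , pm , λ m′ pm′ → ≮⇒≥ (λ m′<m → below b m′ (≤-trans m′<m m≤b) pm′))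

-- Nonconstant colourings.

Varies : ∀ {k} → (Fin k → Bool) → Set
Varies p = ∃[ i ] ∃[ j ] (p i ≡ true × p j ≡ false)

varies? : ∀ {k} (p : Fin k → Bool) → Dec (Varies p)
varies? p = any? (λ i → any? (λ j → (p i ≟ᵇ true) ×-dec (p j ≟ᵇ false)))

¬varies⇒const : ∀ {k} {p : Fin k → Bool} → ¬ Varies p → ∀ i j → p i ≡ p j
¬varies⇒const {p = p} ¬v i j with p i in a | p j in b
... | true  | true  = refl
... | false | false = refl
... | true  | false = ⊥-elim (¬v (i , j , a , b))
... | false | true  = ⊥-elim (¬v (j , i , b , a))

varies-≢ : ∀ {k} {p : Fin k → Bool} → Varies p → ∀ b → ∃[ i ] p i xor b ≡ true
varies-≢ (i , j , pi , pj) true  = j , cong (_xor true) pj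
varies-≢ (i , j , pi , pj) false = i , cong (_xor false) pi

¬true⇒false : ∀ {b} → b ≢ true → b ≡ false
¬true⇒false {true}  h = ⊥-elim (h refl)
¬true⇒false {false} _ = refl

xor-false⇒≡ : ∀ {a b} → a xor b ≡ false → a ≡ b
xor-false⇒≡ {true}  {true}  _ = refl
xor-false⇒≡ {false} {false} _ = refl

-- Lower bounds on costs from frustration, `ρ` and edge connectivity.

module _ (G : Graph) where

  private
    V : Set
    V = Fin (n G)

  monochromatic : (A c : V → Bool) → V → V → Bool
  monochromatic A c i j = adj G i j ∧ ((A i ∧ A j) ∧ not (c i xor c j))

  monochromaticSet : (A c : V → Bool) → EdgeSet G
  monochromaticSet A c = record
    { S    = monochromatic A c
    ; sub  = λ i j → proj₁ ∘ Equivalence.to T-∧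
    ; ssym = λ i j → cong₂ _∧_ (sym G i j) (cong₂ _∧_ (∧-comm (A i) (A j)) (cong not (xor-comm (c i) (c j))))
    }

  -- The predicate that `FrustrationOn G A` minimises.
  deletion : (A : V → Bool) → ℕ → Set
  deletion A k = Σ[ X ∈ EdgeSet G ]
    ((∀ i j → T (S X i j) → T (A i ∧ A j)) ×
     ∣ X ∣ₑ ≡ k ×
     Σ[ c ∈ (Fin (n G) → Bool) ]
       (∀ i j → T (A i ∧ A j ∧ adj G i j ∧ not (S X i j)) → c i ≢ c j))

  -- Any colouring `c` of `A` becomes proper once its monochromatic edges inside `A` are removed.
  monochromatic-deletion : (A c : V → Bool) → deletion A ∣ monochromaticSet A c ∣ₑ
  monochromatic-deletion A c = monochromaticSet A c , inside , refl , c ,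
      λ i j → proper (A i) (A j) (adj G i j) (c i) (c j)
    where
      inside : ∀ i j → T (monochromatic A c i j) → T (A i ∧ A j)
      inside i j = proj₁ ∘ Equivalence.to T-∧ ∘ proj₂ ∘ Equivalence.to (T-∧ {adj G i j})
      proper : ∀ p q a r s → T (p ∧ q ∧ a ∧ not (a ∧ ((p ∧ q) ∧ not (r xor s)))) → r ≢ s
      proper true true true true  false _ ()
      proper true true true false true  _ ()

  frustration≤monochromatic : ∀ A {f} → FrustrationOn G A f → (c : V → Bool) →
    2 * f ≤ ∑∑ (λ i j → ⟦ monochromatic A c i j ⟧)
  frustration≤monochromatic A fr c = subst (_ ≤_) (≡-sym (∑∑-edgeSet G (monochromaticSet A c)))
    (*-monoʳ-≤ 2 (proj₂ fr _ (monochromatic-deletion A c)))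

  module _ (P Q : V → Bool) where

    differ : V → Bool
    differ i = P i xor Q i

    -- The left-hand side is twice the quantity 2m + |[A,B]| minimised by ρ(G),
    -- where P and Q differ exactly on A and m ≥ φ([A]) counts the edges of [A]
    -- that P leaves monochromatic.
    split-cost : 2 * ∑∑ (λ i j → ⟦ monochromatic differ P i j ⟧) + cost G differ differ ≤ 2 * cost G P Q
    split-cost = begin
      2 * ∑∑ m + cost G differ differ      ≡⟨ cong (_+ cost G differ differ) (∑∑-* 2 m) ⟨
      ∑∑ (λ i j → 2 * m i j) + cost G differ differ
                                           ≡⟨ ∑∑-+ (λ i j → 2 * m i j) x ⟨
      ∑∑ (λ i j → 2 * m i j + x i j)       ≤⟨ ∑∑-mono (λ i j → pointwise (adj G i j) (P i) (Q i) (P j) (Q j)) ⟩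
      ∑∑ (λ i j → wt G i j * (⟦ P i xor Q j ⟧ + ⟦ P j xor Q i ⟧))
                                           ≡⟨ cost-double G P Q ⟩
      2 * cost G P Q                       ∎
      where
        open ≤-Reasoning
        m x : V → V → ℕ
        m i j = ⟦ monochromatic differ P i j ⟧
        x i j = wt G i j * ⟦ differ i xor differ j ⟧
        pointwise : ∀ a p q p′ q′ →
          2 * ⟦ a ∧ (((p xor q) ∧ (p′ xor q′)) ∧ not (p xor p′)) ⟧ + ⟦ a ⟧ * ⟦ (p xor q) xor (p′ xor q′) ⟧
            ≤ ⟦ a ⟧ * (⟦ p xor q′ ⟧ + ⟦ p′ xor q ⟧)
        pointwise = toWitness {a? = ∀-Bool? λ a → ∀-Bool? λ p → ∀-Bool? λ q → ∀-Bool? λ p′ → ∀-Bool? λ q′ → _ ≤? _} tt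

    -- Meant for a constant `Q`: a vertex where `P` takes the opposite value has all its incident
    -- pairs cut.
    row≤cost : ∀ {x} → (∀ j → P x xor Q j ≡ true) → deg G x ≤ cost G P Q
    row≤cost {x} h = begin
      deg G x                                     ≡⟨ deg≡sum G x ⟩
      sumFin (wt G x)                             ≡⟨ sum-cong (λ j → ≡-sym (trans (cong (λ b → wt G x j * ⟦ b ⟧) (h j)) (*-identityʳ _))) ⟩
      sumFin (λ j → wt G x j * ⟦ P x xor Q j ⟧)   ≤⟨ term≤sum (λ i → sumFin (λ j → wt G i j * ⟦ P i xor Q j ⟧)) x ⟩
      cost G P Q                                  ∎
      where open ≤-Reasoning

    -- The set `differ` is nonempty, hence admissible in the definition of `ρ`. Colouring it by `P`
    -- bounds its frustration, and `split-cost` bounds the resulting total. The exact frustration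
    -- exists only up to double negation, which suffices for a decidable inequality.
    ρ≤cost : ∀ {r} → Rho G r → ∀ {v} → differ v ≡ true → r ≤ cost G P Q
    ρ≤cost {r} rho {v} dv = decidable-stable (r ≤? cost G P Q) λ r≰ →
      IsMin-exists (monochromatic-deletion differ P) λ { (f , fr) → r≰ (*-cancelˡ-≤ 2 (begin
        2 * r                                 ≤⟨ *-monoʳ-≤ 2 (proj₂ rho _ (differ , (v , Equivalence.from T-≡ dv) , f , fr , refl)) ⟩
        2 * (2 * f + crossEdges G differ)     ≡⟨ *-distribˡ-+ 2 (2 * f) _ ⟩
        2 * (2 * f) + 2 * crossEdges G differ ≤⟨ +-mono-≤ (*-monoʳ-≤ 2 (frustration≤monochromatic differ fr P))
                                                           (≤-reflexive (≡-sym (cost-crossEdges G differ))) ⟩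
        2 * ∑∑ (λ i j → ⟦ monochromatic differ P i j ⟧) + cost G differ differ ≤⟨ split-cost ⟩
        2 * cost G P Q                        ∎)) }
      where open ≤-Reasoning

  module _ {l} (conn : EdgeConnectivity G l) where

    λ≤cost-varies : ∀ {P} → Varies P → 2 * l ≤ cost G P P
    λ≤cost-varies {P} (i , j , Pi , Pj) = λ≤cost G conn P Pi Pj

    λ≤cost-agree : ∀ {P Q} → Varies P → (∀ i → P i ≡ Q i) → 2 * l ≤ cost G P Q
    λ≤cost-agree {P} {Q} var h = subst (2 * l ≤_)
      (∑∑-cong (λ i j → cong (λ b → wt G i j * ⟦ P i xor b ⟧) (h j))) (λ≤cost-varies var)

    module _ (1≤l : 1 ≤ l) where

      -- If `P` and `Q` agree everywhere, the cost is at least 2λ(G). If they agree in some places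
      -- only, `differ` is a proper cut and `split-cost` applies. If they are complementary, the
      -- second alternative must hold, and `P` leaves at least φ(G) edges monochromatic, each of
      -- which is paid for.
      cost-pos : ∀ {P Q} → Varies P →
        (∃[ i ] P i ≡ Q i) ⊎ (∃[ f ] (Frustration G f × 1 ≤ f)) → 1 ≤ cost G P Q
      cost-pos {P} {Q} var reason with any? (λ i → differ P Q i ≟ᵇ true)
      ... | no agree = ≤-trans 1≤l (≤-trans (m≤m+n l _)
              (λ≤cost-agree var (λ i → xor-false⇒≡ (¬true⇒false (λ d → agree (i , d))))))
      ... | yes (x , dx) with any? (λ i → differ P Q i ≟ᵇ false)
      ...   | yes (y , dy) = *-cancelˡ-≤ 2 (≤-trans (*-monoʳ-≤ 2 1≤l)
                (≤-trans (λ≤cost G conn (differ P Q) dx dy)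
                  (≤-trans (m≤n+m _ _) (split-cost P Q))))
      ...   | no everywhere = from reason
        where
          from : _ → 1 ≤ cost G P Q
          from (inj₁ (i , Pi≡Qi)) = ⊥-elim (everywhere (i , same Pi≡Qi))
            where
              same : ∀ {a b} → a ≡ b → a xor b ≡ false
              same {true}  refl = refl
              same {false} refl = refl
          from (inj₂ (f , fr , 1≤f)) = *-cancelˡ-≤ 2 (begin
            2 * 1                                                     ≤⟨ *-monoʳ-≤ 2 (≤-trans 1≤f (m≤m+n f _)) ⟩
            2 * (2 * f)                                               ≤⟨ *-monoʳ-≤ 2 (frustration≤monochromatic (λ _ → true) fr P) ⟩
            2 * ∑∑ (λ i j → ⟦ monochromatic (λ _ → true) P i j ⟧)     ≤⟨ *-monoʳ-≤ 2 (∑∑-mono (λ i j → ≤-reflexive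
              (cong₂ (λ a b → ⟦ adj G i j ∧ ((a ∧ b) ∧ not (P i xor P j)) ⟧) (all i) (all j)))) ⟩
            2 * ∑∑ (λ i j → ⟦ monochromatic (differ P Q) P i j ⟧)     ≤⟨ m≤m+n _ _ ⟩
            2 * ∑∑ (λ i j → ⟦ monochromatic (differ P Q) P i j ⟧) + cost G (differ P Q) (differ P Q)
                                                                      ≤⟨ split-cost P Q ⟩
            2 * cost G P Q                                            ∎)
            where
              open ≤-Reasoning
              all : ∀ i → true ≡ differ P Q i
              all i with differ P Q i in eq
              ... | true  = refl
              ... | false = ⊥-elim (everywhere (i , eq))

-- Pairs of colourings of cost at most 1.

exclusive : ∀ {k} → (P Q : Fin k → Bool) → Fin k → Bool
exclusive P Q i = P i ∧ not (Q i)

exclusive-intro : ∀ {k} (P Q : Fin k → Bool) {i} → P i ≡ true → Q i ≡ false → exclusive P Q i ≡ true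
exclusive-intro P Q Pi Qi rewrite Pi | Qi = refl

exclusive-elim : ∀ {k} (P Q : Fin k → Bool) {i} → exclusive P Q i ≡ true → P i ≡ true × Q i ≡ false
exclusive-elim P Q {i} e with P i | Q i
... | true | false = refl , refl

xor-cases : ∀ {a b} → a xor b ≡ true → (a ≡ true × b ≡ false) ⊎ (a ≡ false × b ≡ true)
xor-cases {true}  {false} _ = inj₁ (refl , refl)
xor-cases {false} {true}  _ = inj₂ (refl , refl)

module _ (G : Graph) where

  private
    V : Set
    V = Fin (n G)

  -- Every edge has an end where `P` and `Q` agree. Exchanging them at that end turns the two mixed
  -- terms into one term for `P` and one for `Q`.
  cost-independent-differ : ∀ P Q →
    (∀ i j → adj G i j ∧ (differ G P Q i ∧ differ G P Q j) ≡ false) →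
    cost G P P + cost G Q Q ≤ 2 * cost G P Q
  cost-independent-differ P Q ind = begin
    cost G P P + cost G Q Q
      ≡⟨ ∑∑-+ (λ i j → wt G i j * ⟦ P i xor P j ⟧) (λ i j → wt G i j * ⟦ Q i xor Q j ⟧) ⟨
    ∑∑ (λ i j → wt G i j * ⟦ P i xor P j ⟧ + wt G i j * ⟦ Q i xor Q j ⟧)
      ≤⟨ ∑∑-mono (λ i j → pointwise (adj G i j) (P i) (Q i) (P j) (Q j) (ind i j)) ⟩
    ∑∑ (λ i j → wt G i j * (⟦ P i xor Q j ⟧ + ⟦ P j xor Q i ⟧))
      ≡⟨ cost-double G P Q ⟩
    2 * cost G P Q ∎
    where
      open ≤-Reasoning
      pointwise : ∀ a p q p′ q′ → a ∧ ((p xor q) ∧ (p′ xor q′)) ≡ false →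
        ⟦ a ⟧ * ⟦ p xor p′ ⟧ + ⟦ a ⟧ * ⟦ q xor q′ ⟧ ≤ ⟦ a ⟧ * (⟦ p xor q′ ⟧ + ⟦ p′ xor q ⟧)
      pointwise = toWitness {a? = ∀-Bool? λ a → ∀-Bool? λ p → ∀-Bool? λ q → ∀-Bool? λ p′ → ∀-Bool? λ q′ →
        (_ ≟ᵇ _) →-dec (_ ≤? _)} tt

  -- No pair starting or ending at `i` contributes to `cost G P Q`.
  Ordinary : (P Q : V → Bool) → V → Set
  Ordinary P Q i = ∀ j → adj G i j ≡ true → P i ≡ Q j × Q i ≡ P j

  Ordinary-swap : ∀ {P Q i} → Ordinary P Q i → Ordinary Q P i
  Ordinary-swap o j a = proj₂ (o j a) , proj₁ (o j a)

  ordinary-neighbour : ∀ P Q {x} → Ordinary P Q x → P x ≡ true → Q x ≡ false →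
    ∀ j → adj G x j ≡ true → exclusive Q P j ≡ true
  ordinary-neighbour P Q o Px Qx j a =
    exclusive-intro Q P (trans (≡-sym (proj₁ (o j a))) Px) (trans (≡-sym (proj₂ (o j a))) Qx)

  ordinary-deg : ∀ P Q {x} → Ordinary P Q x → P x ≡ true → Q x ≡ false → deg G x ≤ cnt (exclusive Q P)
  ordinary-deg P Q o Px Qx = cnt-mono (ordinary-neighbour P Q o Px Qx)

  module _ (P Q : V → Bool) (cost≤1 : cost G P Q ≤ 1) where

    private
      exceptional : V → V → ℕ
      exceptional i j = wt G i j * ⟦ P i xor Q j ⟧

      unique : ∀ {i j i′ j′} → 1 ≤ exceptional i j → 1 ≤ exceptional i′ j′ → i ≡ i′ × j ≡ j′
      unique = ∑∑≤1-unique exceptional cost≤1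

      ordinary-or-exceptional : ∀ i → Ordinary P Q i ⊎ ∃[ j ] (1 ≤ exceptional i j ⊎ 1 ≤ exceptional j i)
      ordinary-or-exceptional i with any? (λ j → (1 ≤? exceptional i j) ⊎-dec (1 ≤? exceptional j i))
      ... | yes w   = inj₂ w
      ... | no none = inj₁ λ j a →
              equal (adj G i j) a (λ e → none (j , inj₁ e))
            , ≡-sym (equal (adj G j i) (trans (sym G j i) a) (λ e → none (j , inj₂ e)))
        where
          equal : ∀ a {p q} → a ≡ true → ¬ (1 ≤ ⟦ a ⟧ * ⟦ p xor q ⟧) → p ≡ q
          equal true {true}  {true}  _ _ = refl
          equal true {false} {false} _ _ = refl
          equal true {true}  {false} _ h = ⊥-elim (h (s≤s z≤n))
          equal true {false} {true}  _ h = ⊥-elim (h (s≤s z≤n))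

      -- Where `P` and `Q` differ at both ends, swapping them complements both colours, which
      -- preserves their being unequal.
      exceptional-flip : ∀ {x y} → differ G P Q x ≡ true → differ G P Q y ≡ true →
        1 ≤ exceptional x y → 1 ≤ exceptional y x
      exceptional-flip {x} {y} dx dy e =
        subst (λ a → 1 ≤ ⟦ a ⟧ * ⟦ P y xor Q x ⟧) (sym G x y)
              (flipped (adj G x y) (P x) (Q x) (P y) (Q y) dx dy e)
        where
          flipped : ∀ a p q p′ q′ → p xor q ≡ true → p′ xor q′ ≡ true →
            1 ≤ ⟦ a ⟧ * ⟦ p xor q′ ⟧ → 1 ≤ ⟦ a ⟧ * ⟦ p′ xor q ⟧
          flipped = toWitness {a? = ∀-Bool? λ a → ∀-Bool? λ p → ∀-Bool? λ q → ∀-Bool? λ p′ → ∀-Bool? λ q′ →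
            (_ ≟ᵇ _) →-dec ((_ ≟ᵇ _) →-dec ((_ ≤? _) →-dec (_ ≤? _)))} tt

    -- At most one ordered pair contributes. Were neither vertex ordinary, that pair would join `x`
    -- and `y`; but then the reversed pair contributes as well, by `exceptional-flip`.
    one-ordinary : ∀ {x y} → x ≢ y → differ G P Q x ≡ true → differ G P Q y ≡ true →
      Ordinary P Q x ⊎ Ordinary P Q y
    one-ordinary {x} {y} x≢y dx dy with ordinary-or-exceptional x | ordinary-or-exceptional y
    ... | inj₁ o | _      = inj₁ o
    ... | inj₂ _ | inj₁ o = inj₂ o
    ... | inj₂ (j , inj₁ e) | inj₂ (k , inj₁ e′) = ⊥-elim (x≢y (proj₁ (unique e e′)))
    ... | inj₂ (j , inj₂ e) | inj₂ (k , inj₂ e′) = ⊥-elim (x≢y (proj₂ (unique e e′)))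
    ... | inj₂ (j , inj₁ e) | inj₂ (k , inj₂ e′) with unique e e′
    ...   | refl , refl = ⊥-elim (x≢y (proj₁ (unique e (exceptional-flip dx dy e))))
    one-ordinary {x} {y} x≢y dx dy | inj₂ (j , inj₂ e) | inj₂ (k , inj₁ e′) with unique e e′
    ...   | refl , refl = ⊥-elim (x≢y (proj₂ (unique e (exceptional-flip dy dx e))))

    exclusive⇒differ : ∀ {i} → exclusive Q P i ≡ true → differ G P Q i ≡ true
    exclusive⇒differ {i} e with P i | Q i
    ... | false | true = refl

    -- All neighbours of `x` lie in `exclusive Q P`. An ordinary one among them has in turn all its
    -- neighbours in `exclusive P Q`. These two sets are disjoint and each has at least `d`
    -- elements.
    exclusive-large : ∀ {d} → (∀ i → d ≤ deg G i) → ∀ {x} → Ordinary P Q x → P x ≡ true → Q x ≡ false →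
      2 * d ≤ cnt (differ G P Q)
    exclusive-large {d} d≤deg {x} o Px Qx = begin
      2 * d                                     ≡⟨ cong (d +_) (+-identityʳ d) ⟩
      d + d                                     ≤⟨ +-mono-≤ d≤PQ (≤-trans (d≤deg x) (ordinary-deg P Q o Px Qx)) ⟩
      cnt (exclusive P Q) + cnt (exclusive Q P) ≡⟨ cong₂ _+_ (cnt≡sum (exclusive P Q)) (cnt≡sum (exclusive Q P)) ⟩
      sumFin (⟦_⟧ ∘ exclusive P Q) + sumFin (⟦_⟧ ∘ exclusive Q P)
                                                ≡⟨ sum-+ (⟦_⟧ ∘ exclusive P Q) (⟦_⟧ ∘ exclusive Q P) ⟨
      sumFin (λ i → ⟦ exclusive P Q i ⟧ + ⟦ exclusive Q P i ⟧)
                                                ≤⟨ sum-mono (λ i → disjoint (P i) (Q i)) ⟩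
      sumFin (⟦_⟧ ∘ differ G P Q)               ≡⟨ cnt≡sum (differ G P Q) ⟨
      cnt (differ G P Q)                        ∎
      where
        open ≤-Reasoning
        disjoint : ∀ p q → ⟦ p ∧ not q ⟧ + ⟦ q ∧ not p ⟧ ≤ ⟦ p xor q ⟧
        disjoint = toWitness {a? = ∀-Bool? λ p → ∀-Bool? λ q → _ ≤? _} tt
        from-neighbour : ∀ {y} → exclusive Q P y ≡ true → Ordinary P Q y → d ≤ cnt (exclusive P Q)
        from-neighbour {y} e oy with exclusive-elim Q P e
        ... | Qy , Py = ≤-trans (d≤deg y) (ordinary-deg Q P (Ordinary-swap {P} {Q} oy) Qy Py)
        d≤PQ : d ≤ cnt (exclusive P Q)
        d≤PQ with d ≤? 1
        -- Here an ordinary neighbour may be missing, but `x` itself lies in `exclusive P Q`.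
        ... | yes d≤1 = ≤-trans d≤1 (cnt-pos (exclusive P Q) (exclusive-intro P Q Px Qx))
        -- Of two distinct neighbours, at least one is ordinary.
        ... | no d≰1 with cnt-two (adj G x) (≤-trans (≰⇒> d≰1) (d≤deg x))
        ...   | y , y′ , y≢y′ , a , a′ with ordinary-neighbour P Q o Px Qx y a | ordinary-neighbour P Q o Px Qx y′ a′
        ...     | e | e′ with one-ordinary y≢y′ (exclusive⇒differ e) (exclusive⇒differ e′)
        ...       | inj₁ oy  = from-neighbour e oy
        ...       | inj₂ oy′ = from-neighbour e′ oy′

  -- Some edge has both ends in `differ`, and one of its ends is ordinary, so `exclusive-large`
  -- applies, possibly with `P` and `Q` exchanged.
  cost≤1⇒differ-large : ∀ {l d} → EdgeConnectivity G l → 1 ≤ l → (∀ i → d ≤ deg G i) →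
    ∀ {P Q} → Varies P → Varies Q → cost G P Q ≤ 1 → 2 * d ≤ cnt (differ G P Q)
  cost≤1⇒differ-large {l} {d} conn 1≤l d≤deg {P} {Q} vP vQ le
    with any? (λ i → any? (λ j → (adj G i j ∧ (differ G P Q i ∧ differ G P Q j)) ≟ᵇ true))
  -- With `differ` independent, the proper cuts `P` and `Q` would cost at least 4 together, against
  -- twice a cost of at most 1.
  ... | no ind = contradiction (begin
        4                       ≤⟨ *-monoʳ-≤ 4 1≤l ⟩
        4 * l                   ≡⟨ double-double l ⟩
        2 * l + 2 * l           ≤⟨ +-mono-≤ (λ≤cost-varies G conn vP) (λ≤cost-varies G conn vQ) ⟩
        cost G P P + cost G Q Q ≤⟨ cost-independent-differ P Q (λ i j → ¬true⇒false (λ t → ind (i , j , t))) ⟩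
        2 * cost G P Q          ≤⟨ *-monoʳ-≤ 2 le ⟩
        2                       ∎) (λ { (s≤s (s≤s ())) })
    where
      open ≤-Reasoning
      double-double : ∀ a → 4 * a ≡ 2 * a + 2 * a
      double-double = solve-∀
  ... | yes (x , y , t) = from-ordinary (one-ordinary P Q le x≢y dx dy)
    where
      unpack : ∀ {a b c} → a ∧ (b ∧ c) ≡ true → a ≡ true × b ≡ true × c ≡ true
      unpack {true} {true} {true} _ = refl , refl , refl
      adjacent-differ : adj G x y ≡ true × differ G P Q x ≡ true × differ G P Q y ≡ true
      adjacent-differ = unpack {adj G x y} {differ G P Q x} {differ G P Q y} t
      dx : differ G P Q x ≡ true
      dx = proj₁ (proj₂ adjacent-differ)
      dy : differ G P Q y ≡ true
      dy = proj₂ (proj₂ adjacent-differ)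
      x≢y : x ≢ y
      x≢y x≡y with trans (≡-sym (irrefl G x)) (subst (λ z → adj G x z ≡ true) (≡-sym x≡y) (proj₁ adjacent-differ))
      ... | ()
      large : ∀ {z} → differ G P Q z ≡ true → Ordinary P Q z → 2 * d ≤ cnt (differ G P Q)
      large dz o with xor-cases dz
      ... | inj₁ (p , q) = exclusive-large P Q le d≤deg o p q
      ... | inj₂ (p , q) = ≤-trans
              (exclusive-large Q P (subst (_≤ 1) (cost-sym G P Q) le) d≤deg (Ordinary-swap {P} {Q} o) q p)
              (cnt-mono (λ i t → trans (xor-comm (P i) (Q i)) t))
      from-ordinary : _ → 2 * d ≤ cnt (differ G P Q)
      from-ordinary (inj₁ o) = large dx o
      from-ordinary (inj₂ o) = large dy o

-- Total weight of the edges meeting a vertex set.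

module _ (G : Graph) {d : ℕ} (d≤deg : ∀ v → d ≤ deg G v) (M : Fin (n G) → Bool)
         (w : Fin (n G) → Fin (n G) → ℕ) where

  private
    V : Set
    V = Fin (n G)

  -- If `M` has fewer than `d` vertices, each of them has many neighbours outside, so at least `d`
  -- edges leave `M`. Each of these weighs at least `d′` in either direction.
  large-or-heavy : ∀ {d′} →
    (∀ i j → adj G i j ≡ true → M i ≡ true → M j ≡ false → d′ ≤ w i j) →
    (∀ i j → adj G i j ≡ true → M i ≡ false → M j ≡ true → d′ ≤ w i j) →
    ∀ {u} → M u ≡ true → d ≤ cnt M ⊎ 2 * (d * d′) ≤ ∑∑ (λ i j → wt G i j * w i j)
  large-or-heavy {d′} tf ft {u} Mu with d ≤? cnt M
  ... | yes d≤ = inj₁ d≤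
  ... | no d≰ = inj₂ (begin
      2 * (d * d′)                                ≤⟨ *-monoʳ-≤ 2 (*-monoˡ-≤ d′ d≤leaving) ⟩
      2 * (∑∑ leave * d′)                         ≡⟨ cong (∑∑ leave * d′ +_) (+-identityʳ _) ⟩
      ∑∑ leave * d′ + ∑∑ leave * d′               ≡⟨ cong (λ s → ∑∑ leave * d′ + s * d′) (sum-swap leave) ⟩
      ∑∑ leave * d′ + ∑∑ (λ i j → leave j i) * d′ ≡⟨ cong₂ _+_ (∑∑-*ʳ leave d′) (∑∑-*ʳ (λ i j → leave j i) d′) ⟨
      ∑∑ (λ i j → leave i j * d′) + ∑∑ (λ i j → leave j i * d′)
                                                  ≡⟨ ∑∑-+ (λ i j → leave i j * d′) (λ i j → leave j i * d′) ⟨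
      ∑∑ (λ i j → leave i j * d′ + leave j i * d′) ≤⟨ ∑∑-mono crossing ⟩
      ∑∑ (λ i j → wt G i j * w i j)               ∎)
    where
      open ≤-Reasoning
      leave : V → V → ℕ
      leave i j = ⟦ M i ⟧ * ⟦ adj G i j ∧ not (M j) ⟧
      out : V → ℕ
      out i = sumFin (λ j → ⟦ adj G i j ∧ not (M j) ⟧)
      x k : ℕ
      x = cnt M
      -- A vertex of `M` is not its own neighbour, so at most `x` - 1 of its neighbours lie in `M`
      -- and at least `d` + 1 - `x` lie outside.
      k = suc d ∸ x
      x<d : x < d
      x<d = ≰⇒> d≰

      deg-split : ∀ i → deg G i ≡ cnt (λ j → adj G i j ∧ M j) + out i
      deg-split i = trans (deg≡sum G i)
        (trans (sum-cong (λ j → halves (adj G i j) (M j)))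
        (trans (sum-+ (λ j → ⟦ adj G i j ∧ M j ⟧) (λ j → ⟦ adj G i j ∧ not (M j) ⟧))
               (cong (_+ out i) (≡-sym (cnt≡sum (λ j → adj G i j ∧ M j))))))
        where
          halves : ∀ a m → ⟦ a ⟧ ≡ ⟦ a ∧ m ⟧ + ⟦ a ∧ not m ⟧
          halves = toWitness {a? = ∀-Bool? λ a → ∀-Bool? λ m → _ ≟ _} tt

      k≤out : ∀ i → ⟦ M i ⟧ * k ≤ ⟦ M i ⟧ * out i
      k≤out i with M i in Mi
      ... | false = z≤n
      ... | true  = *-monoʳ-≤ 1 (m≤n+o⇒m∸n≤o (suc d) x (begin
        suc d                                         ≤⟨ s≤s (d≤deg i) ⟩
        suc (deg G i)                                 ≡⟨ cong suc (deg-split i) ⟩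
        suc (cnt (λ j → adj G i j ∧ M j)) + out i     ≤⟨ +-monoˡ-≤ (out i) fewer ⟩
        x + out i                                     ∎))
        where
          second : ∀ a {m} → a ∧ m ≡ true → m ≡ true
          second true e = e
          fewer : cnt (λ j → adj G i j ∧ M j) < cnt M
          fewer = cnt-mono-< (λ j → second (adj G i j)) (cong (_∧ M i) (irrefl G i)) Mi

      -- With `a` written as a successor, `e` splits into the predecessor and a positive remainder,
      -- and multiplying the predecessor by that remainder does not decrease it.
      product-bound : ∀ a e → 1 ≤ a → a ≤ e → e ≤ a * (suc e ∸ a)
      product-bound (suc a) e _ a<e = begin
        e                    ≡⟨ m+[n∸m]≡n (≤-trans (n≤1+n a) a<e) ⟨
        a + (e ∸ a)          ≡⟨ +-comm a _ ⟩
        (e ∸ a) + a          ≤⟨ +-monoʳ-≤ (e ∸ a) (m≤m*n a (e ∸ a) {{>-nonZero (m<n⇒0<n∸m a<e)}}) ⟩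
        (e ∸ a) + a * (e ∸ a) ∎

      d≤leaving : d ≤ ∑∑ leave
      d≤leaving = begin
        d                               ≤⟨ product-bound x d (cnt-pos M Mu) (≤-trans (n≤1+n x) x<d) ⟩
        x * k                           ≡⟨ cong (_* k) (cnt≡sum M) ⟩
        sumFin (⟦_⟧ ∘ M) * k            ≡⟨ *-comm _ k ⟩
        k * sumFin (⟦_⟧ ∘ M)            ≡⟨ sum-* k (⟦_⟧ ∘ M) ⟨
        sumFin (λ i → k * ⟦ M i ⟧)      ≡⟨ sum-cong (λ i → *-comm k ⟦ M i ⟧) ⟩
        sumFin (λ i → ⟦ M i ⟧ * k)      ≤⟨ sum-mono k≤out ⟩
        sumFin (λ i → ⟦ M i ⟧ * out i)  ≡⟨ sum-cong (λ i → sum-* ⟦ M i ⟧ (λ j → ⟦ adj G i j ∧ not (M j) ⟧)) ⟨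
        ∑∑ leave                        ∎

      crossing : ∀ i j → leave i j * d′ + leave j i * d′ ≤ wt G i j * w i j
      crossing i j rewrite sym G j i with adj G i j in a | M i in Mi | M j in Mj
      ... | false | false | false = z≤n
      ... | false | false | true  = z≤n
      ... | false | true  | false = z≤n
      ... | false | true  | true  = z≤n
      ... | true  | false | false = z≤n
      ... | true  | true  | true  = z≤n
      ... | true  | true  | false = ≤-trans (≤-reflexive (+-identityʳ _)) (*-monoʳ-≤ 1 (tf i j a Mi Mj))
      ... | true  | false | true  = *-monoʳ-≤ 1 (ft i j a Mi Mj)

  -- The degrees over `M` sum to at least `d * cnt M`. An edge inside `M` is counted at both ends
  -- and weighs at least `κ`; an edge leaving `M` is counted once and weighs at least 1, which is at
  -- least half of `κ`.
  mass-bound : ∀ {κ} → κ ≤ 2 →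
    (∀ i j → adj G i j ≡ true → M i ≡ true → M j ≡ true → κ ≤ w i j) →
    (∀ i j → adj G i j ≡ true → M i ≡ true → M j ≡ false → 1 ≤ w i j) →
    (∀ i j → adj G i j ≡ true → M i ≡ false → M j ≡ true → 1 ≤ w i j) →
    κ * (d * cnt M) ≤ ∑∑ (λ i j → wt G i j * w i j)
  mass-bound {κ} κ≤2 tt′ tf ft = *-cancelˡ-≤ 2 (begin
      2 * (κ * (d * cnt M))                  ≡⟨ rearrange κ (d * cnt M) ⟩
      κ * (d * cnt M + d * cnt M)            ≤⟨ *-monoʳ-≤ κ (+-mono-≤ d*cnt≤ (≤-trans d*cnt≤ (≤-reflexive (sum-swap row)))) ⟩
      κ * (∑∑ row + ∑∑ (λ i j → row j i))    ≡⟨ cong (κ *_) (∑∑-+ row (λ i j → row j i)) ⟨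
      κ * ∑∑ (λ i j → row i j + row j i)     ≡⟨ ∑∑-* κ (λ i j → row i j + row j i) ⟨
      ∑∑ (λ i j → κ * (row i j + row j i))   ≤⟨ ∑∑-mono pointwise ⟩
      ∑∑ (λ i j → 2 * (wt G i j * w i j))    ≡⟨ ∑∑-* 2 (λ i j → wt G i j * w i j) ⟩
      2 * ∑∑ (λ i j → wt G i j * w i j)      ∎)
    where
      open ≤-Reasoning
      rearrange : ∀ a b → 2 * (a * b) ≡ a * (b + b)
      rearrange = solve-∀
      row : V → V → ℕ
      row i j = ⟦ M i ⟧ * wt G i j
      d*cnt≤ : d * cnt M ≤ ∑∑ row
      d*cnt≤ = begin
        d * cnt M                             ≡⟨ cong (d *_) (cnt≡sum M) ⟩
        d * sumFin (⟦_⟧ ∘ M)                  ≡⟨ sum-* d (⟦_⟧ ∘ M) ⟨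
        sumFin (λ i → d * ⟦ M i ⟧)            ≤⟨ sum-mono (λ i → ≤-trans (≤-reflexive (*-comm d ⟦ M i ⟧))
                                                  (*-monoʳ-≤ ⟦ M i ⟧ (≤-trans (d≤deg i) (≤-reflexive (deg≡sum G i))))) ⟩
        sumFin (λ i → ⟦ M i ⟧ * sumFin (wt G i)) ≡⟨ sum-cong (λ i → sum-* ⟦ M i ⟧ (wt G i)) ⟨
        ∑∑ row                                ∎
      κ*1≤ : ∀ {y} → 1 ≤ y → κ * 1 ≤ 2 * (1 * y)
      κ*1≤ {y} 1≤y = *-mono-≤ κ≤2 (*-monoʳ-≤ 1 1≤y)
      pointwise : ∀ i j → κ * (row i j + row j i) ≤ 2 * (wt G i j * w i j)
      pointwise i j rewrite sym G j i with adj G i j in a | M i in Mi | M j in Mj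
      ... | false | false | false = ≤-reflexive (*-zeroʳ κ)
      ... | false | false | true  = ≤-reflexive (*-zeroʳ κ)
      ... | false | true  | false = ≤-reflexive (*-zeroʳ κ)
      ... | false | true  | true  = ≤-reflexive (*-zeroʳ κ)
      ... | true  | false | false = ≤-trans (≤-reflexive (*-zeroʳ κ)) z≤n
      ... | true  | true  | false = κ*1≤ (tf i j a Mi Mj)
      ... | true  | false | true  = κ*1≤ (ft i j a Mi Mj)
      ... | true  | true  | true  = ≤-trans (≤-reflexive (*-comm κ 2))
              (*-monoʳ-≤ 2 (≤-trans (tt′ i j a Mi Mj) (m≤m+n _ 0)))

-- Cuts of the product as sums of row costs.

module _ (G H : Graph) where

  -- Twice the number of product edges cut by `F`, since each edge of `G` is visited in both
  -- directions.
  cutSum : (Fin (n G) → Fin (n H) → Bool) → ℕ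
  cutSum F = ∑∑ (λ i j → wt G i j * cost H (F i) (F j))

  cutSum-heavy : ∀ F k → (∀ i j → adj G i j ≡ true → k ≤ cost H (F i) (F j)) → 2 * ∣E∣ G * k ≤ cutSum F
  cutSum-heavy F k h = begin
    2 * ∣E∣ G * k                 ≡⟨ cong (_* k) (∑∑-wt G) ⟨
    ∑∑ (wt G) * k                 ≡⟨ ∑∑-*ʳ (wt G) k ⟨
    ∑∑ (λ i j → wt G i j * k)     ≤⟨ ∑∑-mono pointwise ⟩
    cutSum F                      ∎
    where
      open ≤-Reasoning
      pointwise : ∀ i j → wt G i j * k ≤ wt G i j * cost H (F i) (F j)
      pointwise i j with adj G i j in a
      ... | false = z≤n
      ... | true  = *-monoʳ-≤ 1 (h i j a)

-- The duality between rows and columns: every bound for rows yields one for columns.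
cutSum-flip : ∀ G H F → cutSum G H F ≡ cutSum H G (flip F)
cutSum-flip G H F = begin
  ∑∑ (λ i j → wt G i j * ∑∑ (λ a b → wt H a b * x i j a b))
    ≡⟨ ∑∑-cong (λ i j → ∑∑-* (wt G i j) (λ a b → wt H a b * x i j a b)) ⟨
  ∑∑ (λ i j → ∑∑ (λ a b → wt G i j * (wt H a b * x i j a b)))
    ≡⟨ ∑∑-swap (λ i j a b → wt G i j * (wt H a b * x i j a b)) ⟩
  ∑∑ (λ a b → ∑∑ (λ i j → wt G i j * (wt H a b * x i j a b)))
    ≡⟨ ∑∑-cong (λ a b → ∑∑-cong (λ i j → exchange (wt G i j) (wt H a b) (x i j a b))) ⟩
  ∑∑ (λ a b → ∑∑ (λ i j → wt H a b * (wt G i j * x i j a b)))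
    ≡⟨ ∑∑-cong (λ a b → ∑∑-* (wt H a b) (λ i j → wt G i j * x i j a b)) ⟩
  ∑∑ (λ a b → wt H a b * ∑∑ (λ i j → wt G i j * x i j a b)) ∎
  where
    open ≡-Reasoning
    x : Fin (n G) → Fin (n G) → Fin (n H) → Fin (n H) → ℕ
    x i j a b = ⟦ F i a xor F j b ⟧
    exchange : ∀ p q r → p * (q * r) ≡ q * (p * r)
    exchange = solve-∀

geometric-mean : ∀ k a b {t} → k * (a * a) ≤ t → k * (b * b) ≤ t → k * (a * b) ≤ t
geometric-mean k a b aa bb with ≤-total a b
... | inj₁ a≤b = ≤-trans (*-monoʳ-≤ k (*-monoˡ-≤ b a≤b)) bb
... | inj₂ b≤a = ≤-trans (*-monoʳ-≤ k (*-monoʳ-≤ a b≤a)) aa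

¬varies⇒varies-≢ : ∀ {k} {p q : Fin k → Bool} → Varies p → ¬ Varies q → ∃[ i ] ∀ j → p i xor q j ≡ true
¬varies⇒varies-≢ {p = p} {q} vp ¬vq with varies-≢ vp (q (proj₁ vp))
... | i , e = i , λ j → trans (cong (p i xor_) (¬varies⇒const ¬vq j (proj₁ vp))) e

-- Constant and varying rows of a cut.

varying : ∀ {k l} → (Fin k → Fin l → Bool) → Fin k → Bool
varying F i = does (varies? (F i))

varying⇒Varies : ∀ {k l} (F : Fin k → Fin l → Bool) {i} → varying F i ≡ true → Varies (F i)
varying⇒Varies F {i} e with varies? (F i)
... | yes v = v

¬varying⇒¬Varies : ∀ {k l} (F : Fin k → Fin l → Bool) {i} → varying F i ≡ false → ¬ Varies (F i)
¬varying⇒¬Varies F {i} e with varies? (F i)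
... | no ¬v = ¬v

module _ (G H : Graph) (F : Fin (n G) → Fin (n H) → Bool) {l} (conn : EdgeConnectivity H l) where

  equal-rows-heavy : (∀ g g′ h → F g h ≡ F g′ h) → ∀ {g} → Varies (F g) →
    2 * (2 * l * ∣E∣ G) ≤ cutSum G H F
  equal-rows-heavy eq {g} v = ≤-trans (≤-reflexive (rearrange l (∣E∣ G)))
    (cutSum-heavy G H F (2 * l) λ i j _ →
      λ≤cost-agree H conn (subst-varies (eq g i) v) (eq i j))
    where
      rearrange : ∀ a e → 2 * (2 * a * e) ≡ 2 * e * (2 * a)
      rearrange = solve-∀
      subst-varies : ∀ {p q : Fin (n H) → Bool} → (∀ h → p h ≡ q h) → Varies p → Varies q
      subst-varies h (i , j , a , b) = i , j , trans (≡-sym (h i)) a , trans (≡-sym (h j)) b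

  -- A pair of rows costs at least 2λ(H) if they are equal and at least ρ(H) otherwise, so the
  -- smaller of the two numbers bounds all pairs uniformly.
  varying-rows-heavy : ∀ {r} → Rho H r → (∀ g → Varies (F g)) →
    2 * (2 * l * ∣E∣ G) ≤ cutSum G H F ⊎ 2 * (r * ∣E∣ G) ≤ cutSum G H F
  varying-rows-heavy {r} rho v = choose (≤-total (2 * l) r)
    where
      rearrange : ∀ a e → 2 * (a * e) ≡ 2 * e * a
      rearrange = solve-∀
      heavy : ∀ k → (∀ i j → k ≤ cost H (F i) (F j)) → 2 * (k * ∣E∣ G) ≤ cutSum G H F
      heavy k h = ≤-trans (≤-reflexive (rearrange k (∣E∣ G))) (cutSum-heavy G H F k (λ i j _ → h i j))
      edge : ∀ i j → 2 * l ≤ cost H (F i) (F j) ⊎ r ≤ cost H (F i) (F j)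
      edge i j with any? (λ h → differ H (F i) (F j) h ≟ᵇ true)
      ... | yes (h , d) = inj₂ (ρ≤cost H (F i) (F j) rho d)
      ... | no agree = inj₁ (λ≤cost-agree H conn (v i) (λ h → xor-false⇒≡ (¬true⇒false (λ d → agree (h , d)))))
      choose : 2 * l ≤ r ⊎ r ≤ 2 * l → _
      choose (inj₁ 2l≤r) = inj₁ (heavy (2 * l) (λ i j → [ (λ x → x) , ≤-trans 2l≤r ]′ (edge i j)))
      choose (inj₂ r≤2l) = inj₂ (heavy r (λ i j → [ ≤-trans r≤2l , (λ x → x) ]′ (edge i j)))

  module _ (1≤l : 1 ≤ l) {d d′} (d≤deg : ∀ g → d ≤ deg G g) (1≤d′ : 1 ≤ d′) (d′≤deg : ∀ h → d′ ≤ deg H h)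
           (nonbipartite : (∃[ h ] ¬ Varies (flip F h)) ⊎ (∃[ f ] (Frustration H f × 1 ≤ f))) where

    private
      M : Fin (n G) → Bool
      M = varying F
      N : Fin (n H) → Bool
      N = varying (flip F)
      c : Fin (n G) → Fin (n G) → ℕ
      c i j = cost H (F i) (F j)

      varying-const : ∀ {i j} → M i ≡ true → M j ≡ false → d′ ≤ c i j
      varying-const {i} {j} Mi Mj with ¬varies⇒varies-≢ (varying⇒Varies F Mi) (¬varying⇒¬Varies F Mj)
      ... | x , h = ≤-trans (d′≤deg x) (row≤cost H (F i) (F j) h)

      const-varying : ∀ {i j} → M i ≡ false → M j ≡ true → d′ ≤ c i j
      const-varying {i} {j} Mi Mj = subst (d′ ≤_) (cost-sym H (F j) (F i)) (varying-const Mj Mi)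

      differ⇒varying : ∀ i j {h} → differ H (F i) (F j) h ≡ true → N h ≡ true
      differ⇒varying i j {h} dh = dec-true (varies? (flip F h)) (witness (xor-cases dh))
        where
          witness : _ → Varies (flip F h)
          witness (inj₁ (p , q)) = i , j , p , q
          witness (inj₂ (p , q)) = j , i , q , p

      -- A constant column is a place where any two rows agree, and φ(H) ≥ 1 rules out free
      -- complementary rows; `cost-pos` accepts either.
      inner-pos : ∀ {i j} → M i ≡ true → 1 ≤ c i j
      inner-pos {i} {j} Mi = cost-pos H conn 1≤l (varying⇒Varies F Mi) (reason nonbipartite)
        where
          reason : _ → (∃[ h ] F i h ≡ F j h) ⊎ (∃[ f ] (Frustration H f × 1 ≤ f))
          reason (inj₁ (h , ¬v)) = inj₁ (h , ¬varies⇒const ¬v i j)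
          reason (inj₂ f)        = inj₂ f

      mass : ∀ κ → κ ≤ 2 → (∀ i j → adj G i j ≡ true → M i ≡ true → M j ≡ true → κ ≤ c i j) →
        κ * (d * cnt M) ≤ cutSum G H F
      mass κ κ≤2 inner = mass-bound G d≤deg M c κ≤2 inner
        (λ i j _ p q → ≤-trans 1≤d′ (varying-const p q))
        (λ i j _ p q → ≤-trans 1≤d′ (const-varying p q))

    varying-large : ∀ {g} → Varies (F g) → d ≤ cnt (varying F) ⊎ 2 * (d * d′) ≤ cutSum G H F
    varying-large {g} v = large-or-heavy G d≤deg M c
      (λ i j _ → varying-const) (λ i j _ → const-varying) (dec-true (varies? (F g)) v)

    -- If any two varying rows cost at least 2, `mass-bound` applies with `κ` equal to 2. Otherwise
    -- it applies with 1, and a cheap pair of rows differs in at least `2 * d′` columns, all of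
    -- which vary.
    varying-mass : 2 * (d * cnt (varying F)) ≤ cutSum G H F ⊎
                   (d * cnt (varying F) ≤ cutSum G H F × 2 * d′ ≤ cnt (varying (flip F)))
    varying-mass with any? (λ i → any? (λ j → (M i ≟ᵇ true) ×-dec ((M j ≟ᵇ true) ×-dec (c i j ≤? 1))))
    ... | no none = inj₁ (mass 2 ≤-refl (λ i j _ p q → ≰⇒> (λ le → none (i , j , p , q , le))))
    ... | yes (i , j , p , q , le) = inj₂
          ( ≤-trans (≤-reflexive (≡-sym (+-identityʳ _))) (mass 1 (s≤s z≤n) (λ _ _ _ p _ → inner-pos p))
          , ≤-trans (cost≤1⇒differ-large H conn 1≤l d′≤deg (varying⇒Varies F p) (varying⇒Varies F q) le)
                    (cnt-mono {p = differ H (F i) (F j)} {q = N} (λ h → differ⇒varying i j)))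

-- Each mass bound yields a bound on a square, and `geometric-mean` multiplies them. A row bound
-- weakened to coefficient 1 comes with the doubled bound on `y`, so the column square becomes that
-- of `2 * d′`; dually for `x`.
combine-masses : ∀ {d d′ x y t} → d ≤ x → d′ ≤ y →
  2 * (d * x) ≤ t ⊎ (d * x ≤ t × 2 * d′ ≤ y) →
  2 * (d′ * y) ≤ t ⊎ (d′ * y ≤ t × 2 * d ≤ x) →
  2 * (d * d′) ≤ t
combine-masses {d} {d′} {x} {y} {t} d≤x d′≤y = go
  where
    open ≤-Reasoning
    one : ∀ a {b c} → a * b ≤ t → c ≤ b → 1 * (a * c) ≤ t
    one a le c≤b = ≤-trans (≤-reflexive (+-identityʳ _)) (≤-trans (*-monoʳ-≤ a c≤b) le)
    two : ∀ a {b c} → 2 * (a * b) ≤ t → c ≤ b → 2 * (a * c) ≤ t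
    two a le c≤b = ≤-trans (*-monoʳ-≤ 2 (*-monoʳ-≤ a c≤b)) le
    1*[2a*2a] : ∀ a → 1 * ((2 * a) * (2 * a)) ≡ 2 * (a * (2 * a))
    1*[2a*2a] = solve-∀
    2*[a*a] : ∀ a → 2 * (a * a) ≡ 1 * (a * (2 * a))
    2*[a*a] = solve-∀
    left : ∀ a b → 2 * (a * b) ≡ 1 * ((2 * a) * b)
    left = solve-∀
    right : ∀ a b → 2 * (a * b) ≡ 1 * (a * (2 * b))
    right = solve-∀
    go : _ → _ → 2 * (d * d′) ≤ t
    go (inj₁ p) (inj₁ q) = geometric-mean 2 d d′ (two d p d≤x) (two d′ q d′≤y)
    go (inj₂ (p , 2d′≤y)) (inj₁ q) = begin
      2 * (d * d′)         ≡⟨ right d d′ ⟩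
      1 * (d * (2 * d′))   ≤⟨ geometric-mean 1 d (2 * d′) (one d p d≤x) (≤-trans (≤-reflexive (1*[2a*2a] d′)) (two d′ q 2d′≤y)) ⟩
      t                    ∎
    go (inj₁ p) (inj₂ (q , 2d≤x)) = begin
      2 * (d * d′)         ≡⟨ left d d′ ⟩
      1 * ((2 * d) * d′)   ≤⟨ geometric-mean 1 (2 * d) d′ (≤-trans (≤-reflexive (1*[2a*2a] d)) (two d p 2d≤x)) (one d′ q d′≤y) ⟩
      t                    ∎
    go (inj₂ (p , 2d′≤y)) (inj₂ (q , 2d≤x)) = geometric-mean 2 d d′
      (≤-trans (≤-reflexive (2*[a*a] d)) (one d p 2d≤x)) (≤-trans (≤-reflexive (2*[a*a] d′)) (one d′ q 2d′≤y))

-- In the remaining case all columns vary and φ(H) = 0, so `varying-rows-heavy` applies to the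
-- columns and ψ(G, H) reduces to ρ(G)|E(H)|.
nonbipartite-or-heavy : ∀ G H F {l r f} → EdgeConnectivity G l → Rho G r → Frustration H f →
  ((∃[ h ] ¬ Varies (flip F h)) ⊎ (∃[ f′ ] (Frustration H f′ × 1 ≤ f′))) ⊎
  (2 * (2 * l * ∣E∣ H) ≤ cutSum H G (flip F) ⊎ 2 * ψ G H r f ≤ cutSum H G (flip F))
nonbipartite-or-heavy G H F {l} {r} {f} conn rho fr with any? (λ h → ¬? (varies? (flip F h))) | f
... | yes w | _     = inj₁ (inj₁ w)
... | no _  | suc k = inj₁ (inj₂ (suc k , fr , s≤s z≤n))
... | no ¬w | zero  = inj₂ (weaken (varying-rows-heavy H G (flip F) conn rho
                        (λ h → decidable-stable (varies? (flip F h)) (λ ¬v → ¬w (h , ¬v)))))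
  where
    weaken : _ → _
    weaken (inj₁ h) = inj₁ h
    weaken (inj₂ h) = inj₂ (≤-trans (≤-reflexive (cong (2 *_) (+-identityʳ (r * ∣E∣ H)))) h)

-- The lower bound for every cut of the product.

module _ (G H : Graph) {λG λH ρG ρH φG φH d d′ : ℕ}
  (connG : EdgeConnectivity G λG) (connH : EdgeConnectivity H λH)
  (rhoG : Rho G ρG) (rhoH : Rho H ρH) (frG : Frustration G φG) (frH : Frustration H φH)
  (d≤deg : ∀ g → d ≤ deg G g) (d′≤deg : ∀ h → d′ ≤ deg H h) where

  minimum : ℕ
  minimum = (2 * λG * ∣E∣ H) ⊓ (2 * λH * ∣E∣ G) ⊓ (d * d′) ⊓ ψ G H ρG φH ⊓ ψ H G ρH φG

  cut-lower-bound : 1 ≤ λG → 1 ≤ λH → 1 ≤ d → 1 ≤ d′ →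
    ∀ F {g h g′ h′} → F g h ≡ true → F g′ h′ ≡ false → 2 * minimum ≤ cutSum G H F
  cut-lower-bound 1≤λG 1≤λH 1≤d 1≤d′ F {g₀} {h₀} {g₁} {h₁} Ft Ff =
      outer (any? (λ g → varies? (F g))) (any? (λ h → varies? (flip F h)))
    where
      a b p q : ℕ
      a = 2 * λG * ∣E∣ H
      b = 2 * λH * ∣E∣ G
      p = ψ G H ρG φH
      q = ψ H G ρH φG
      Goal : Set
      Goal = 2 * minimum ≤ cutSum G H F
      unflip : ∀ {x} → x ≤ cutSum H G (flip F) → x ≤ cutSum G H F
      unflip = subst (_ ≤_) (≡-sym (cutSum-flip G H F))
      via : ∀ {x} → minimum ≤ x → 2 * x ≤ cutSum G H F → Goal
      via le h = ≤-trans (*-monoʳ-≤ 2 le) h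
      ≤q : minimum ≤ q
      ≤q = m⊓n≤n _ q
      ≤p : minimum ≤ p
      ≤p = ≤-trans (m⊓n≤m _ q) (m⊓n≤n _ p)
      ≤δ : minimum ≤ d * d′
      ≤δ = ≤-trans (m⊓n≤m _ q) (≤-trans (m⊓n≤m _ p) (m⊓n≤n (a ⊓ b) (d * d′)))
      ≤ab : minimum ≤ a ⊓ b
      ≤ab = ≤-trans (m⊓n≤m _ q) (≤-trans (m⊓n≤m _ p) (m⊓n≤m (a ⊓ b) (d * d′)))
      ≤a : minimum ≤ a
      ≤a = ≤-trans ≤ab (m⊓n≤m a b)
      ≤b : minimum ≤ b
      ≤b = ≤-trans ≤ab (m⊓n≤n a b)

      -- Either `large-or-heavy` already finishes for rows or for columns, or there are at least `d`
      -- varying rows and `d′` varying columns and the mass bounds combine.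
      dense : (∃[ g ] Varies (F g)) → (∃[ h ] Varies (flip F h)) →
        (∃[ h ] ¬ Varies (flip F h)) ⊎ (∃[ f ] (Frustration H f × 1 ≤ f)) →
        (∃[ g ] ¬ Varies (F g)) ⊎ (∃[ f ] (Frustration G f × 1 ≤ f)) → Goal
      dense (g , vg) (h , vh) nbH nbG = via ≤δ (sizes
          (varying-large G H F connH 1≤λH d≤deg 1≤d′ d′≤deg nbH vg)
          (varying-large H G (flip F) connG 1≤λG d′≤deg 1≤d d≤deg nbG vh))
        where
          unflip-mass : _ → 2 * (d′ * cnt (varying (flip F))) ≤ cutSum G H F ⊎
            (d′ * cnt (varying (flip F)) ≤ cutSum G H F × 2 * d ≤ cnt (varying F))
          unflip-mass (inj₁ m)       = inj₁ (unflip m)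
          unflip-mass (inj₂ (m , s)) = inj₂ (unflip m , s)
          sizes : _ → _ → 2 * (d * d′) ≤ cutSum G H F
          sizes (inj₂ t) _ = t
          sizes (inj₁ _) (inj₂ t) = subst (λ x → 2 * x ≤ cutSum G H F) (*-comm d′ d) (unflip t)
          sizes (inj₁ x) (inj₁ y) = combine-masses x y
            (varying-mass G H F connH 1≤λH d≤deg 1≤d′ d′≤deg nbH)
            (unflip-mass (varying-mass H G (flip F) connG 1≤λG d′≤deg 1≤d d≤deg nbG))

      inner : (∃[ g ] Varies (F g)) → (∃[ h ] Varies (flip F h)) → _ → _ → Goal
      inner vg vh (inj₂ (inj₁ t)) _ = via ≤a (unflip t)
      inner vg vh (inj₂ (inj₂ t)) _ = via ≤p (unflip t)
      inner vg vh (inj₁ _) (inj₂ (inj₁ t)) = via ≤b t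
      inner vg vh (inj₁ _) (inj₂ (inj₂ t)) = via ≤q t
      inner vg vh (inj₁ nbH) (inj₁ nbG) = dense vg vh nbH nbG

      outer : Dec (∃[ g ] Varies (F g)) → Dec (∃[ h ] Varies (flip F h)) → Goal
      -- Constant rows make all columns equal. The column at `h₀` varies, because the constant row
      -- `g₁` carries the value false over to `h₀`.
      outer (no none) _ = via ≤a (unflip (equal-rows-heavy H G (flip F) connG
        (λ h h′ g → ¬varies⇒const (λ v → none (g , v)) h h′)
        (g₀ , g₁ , Ft , trans (¬varies⇒const (λ v → none (g₁ , v)) h₀ h₁) Ff)))
      outer (yes _) (no none) = via ≤b (equal-rows-heavy G H F connH
        (λ g g′ h → ¬varies⇒const (λ v → none (h , v)) g g′)
        (h₀ , h₁ , Ft , trans (¬varies⇒const (λ v → none (h₁ , v)) g₀ g₁) Ff))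
      outer (yes vg) (yes vh) = inner vg vh
        (nonbipartite-or-heavy G H F connG rhoG frH)
        (nonbipartite-or-heavy H G (flip F) connH rhoH frG)

-- Isolating `v` is a proper cut because `u` remains on the other side.
λ≤deg : ∀ K {l} → EdgeConnectivity K l → ∀ {u v} → u ≢ v → l ≤ deg K v
λ≤deg K {l} conn {u} {v} u≢v = *-cancelˡ-≤ 2 (begin
  2 * l                              ≤⟨ λ≤cost K conn A {v} {u} (dec-true (v ≟ꟳ v) refl) (dec-false (u ≟ꟳ v) u≢v) ⟩
  cost K A A                         ≤⟨ ∑∑-mono pointwise ⟩
  ∑∑ (λ i j → row i j + row j i)     ≡⟨ ∑∑-+ row (λ i j → row j i) ⟩
  ∑∑ row + ∑∑ (λ i j → row j i)      ≡⟨ cong (∑∑ row +_) (sum-swap row) ⟨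
  ∑∑ row + ∑∑ row                    ≡⟨ cong (λ x → x + x) ∑∑-row ⟩
  deg K v + deg K v                  ≡⟨ cong (deg K v +_) (+-identityʳ _) ⟨
  2 * deg K v                        ∎)
  where
    open ≤-Reasoning
    A : Fin (n K) → Bool
    A i = does (i ≟ꟳ v)
    row : Fin (n K) → Fin (n K) → ℕ
    row i j = ⟦ A i ⟧ * wt K i j
    ∑∑-row : ∑∑ row ≡ deg K v
    ∑∑-row = trans (sum-cong (λ i → sum-* ⟦ A i ⟧ (wt K i)))
             (trans (sum-indicator v (λ i → sumFin (wt K i))) (≡-sym (deg≡sum K v)))
    either : ∀ e a b → ⟦ e ⟧ * ⟦ a xor b ⟧ ≤ ⟦ a ⟧ * ⟦ e ⟧ + ⟦ b ⟧ * ⟦ e ⟧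
    either = toWitness {a? = ∀-Bool? λ e → ∀-Bool? λ a → ∀-Bool? λ b → _ ≤? _} tt
    pointwise : ∀ i j → wt K i j * ⟦ A i xor A j ⟧ ≤ row i j + row j i
    pointwise i j = subst (λ e → wt K i j * ⟦ A i xor A j ⟧ ≤ row i j + ⟦ A j ⟧ * ⟦ e ⟧) (sym K i j)
                          (either (adj K i j) (A i) (A j))

-- Cuts and degrees of the product graph.

module _ (G H : Graph) where

  private
    K : Graph
    K = G ×ᵍ H

  cost-product : ∀ A F → (∀ p → A p ≡ F (fstV G H p) (sndV G H p)) → cost K A A ≡ cutSum G H F
  cost-product A F A≡F = begin
    cost K A A
      ≡⟨ ∑∑-cong (λ p q → trans (cong₂ (λ x y → wt K p q * ⟦ x xor y ⟧) (A≡F p) (A≡F q))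
           (trans (cong (_* ⟦ F (fstV G H p) (sndV G H p) xor F (fstV G H q) (sndV G H q) ⟧) (⟦∧⟧ (adj G (fstV G H p) (fstV G H q)) _)) (*-assoc (wt G _ _) _ _))) ⟩
    sumFin (λ p → sumFin (λ q → e (remQuot {n G} (n H) p) (remQuot {n G} (n H) q)))
      ≡⟨ sum-cong (λ p → sum-remQuot (n H) (e (remQuot {n G} (n H) p))) ⟩
    sumFin (λ p → inner (remQuot {n G} (n H) p))
      ≡⟨ sum-remQuot (n H) inner ⟩
    sumFin (λ i → sumFin (λ a → sumFin (λ j → sumFin (λ b → e (i , a) (j , b)))))
      ≡⟨ sum-cong (λ i → sum-swap (λ a j → sumFin (λ b → e (i , a) (j , b)))) ⟩
    ∑∑ (λ i j → ∑∑ (λ a b → e (i , a) (j , b)))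
      ≡⟨ ∑∑-cong (λ i j → ∑∑-* (wt G i j) (λ a b → wt H a b * ⟦ F i a xor F j b ⟧)) ⟩
    cutSum G H F ∎
    where
      open ≡-Reasoning
      e : Fin (n G) × Fin (n H) → Fin (n G) × Fin (n H) → ℕ
      e (i , a) (j , b) = wt G i j * (wt H a b * ⟦ F i a xor F j b ⟧)
      inner : Fin (n G) × Fin (n H) → ℕ
      inner r = sumFin (λ j → sumFin (λ b → e r (j , b)))

  deg-product : ∀ p → deg K p ≡ deg G (fstV G H p) * deg H (sndV G H p)
  deg-product p = begin
    deg K p                                   ≡⟨ deg≡sum K p ⟩
    sumFin (wt K p)                           ≡⟨ sum-cong (λ q → ⟦∧⟧ (adj G (fstV G H p) (fstV G H q)) _) ⟩
    sumFin (λ q → e (remQuot {n G} (n H) q))  ≡⟨ sum-remQuot (n H) e ⟩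
    sumFin (λ j → sumFin (λ b → wt G g j * wt H h b))
                                              ≡⟨ sum-cong (λ j → trans (sum-* (wt G g j) (wt H h)) (*-comm (wt G g j) _)) ⟩
    sumFin (λ j → sumFin (wt H h) * wt G g j) ≡⟨ sum-* (sumFin (wt H h)) (wt G g) ⟩
    sumFin (wt H h) * sumFin (wt G g)         ≡⟨ *-comm (sumFin (wt H h)) _ ⟩
    sumFin (wt G g) * sumFin (wt H h)         ≡⟨ cong₂ _*_ (deg≡sum G g) (deg≡sum H h) ⟨
    deg G g * deg H h                         ∎
    where
      open ≡-Reasoning
      g : Fin (n G)
      g = fstV G H p
      h : Fin (n H)
      h = sndV G H p
      e : Fin (n G) × Fin (n H) → ℕ
      e (j , b) = wt G g j * wt H h b

-- Upper bounds from explicit colourings.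

IsNonconstant : ∀ {k l} → (Fin k → Fin l → Bool) → Set
IsNonconstant F = ∃[ g ] ∃[ h ] ∃[ g′ ] ∃[ h′ ] (F g h ≡ true × F g′ h′ ≡ false)

module _ (G H : Graph) {l : ℕ} (l≤cut : ∀ F → IsNonconstant F → 2 * l ≤ cutSum G H F)
         (some : Σ[ F ∈ (Fin (n G) → Fin (n H) → Bool) ] IsNonconstant F) (h₀ : Fin (n H)) where

  -- A minimum cut of `G`, extended constantly along `H`, cuts two product edges for each cut edge
  -- of `G` and each edge of `H`.
  ≤2λ∣E∣ : ∀ {m} → EdgeConnectivity G m → l ≤ 2 * m * ∣E∣ H
  ≤2λ∣E∣ {m} ((X , ∣X∣≡m , inj₁ disc) , _) = decidable-stable (_ ≤? _) λ l≰ →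
    disconnected⇒cut G X disc λ { (A , u , v , Au , Av , costA) → l≰ (*-cancelˡ-≤ 2 (begin
      2 * l                             ≤⟨ l≤cut (λ g _ → A g) (u , h₀ , v , h₀ , Au , Av) ⟩
      cutSum G H (λ g _ → A g)          ≡⟨ cutSum-flip G H (λ g _ → A g) ⟩
      ∑∑ (λ a b → wt H a b * cost G A A) ≡⟨ ∑∑-*ʳ (wt H) (cost G A A) ⟩
      ∑∑ (wt H) * cost G A A            ≤⟨ *-mono-≤ (≤-reflexive (∑∑-wt H)) (subst (λ k → cost G A A ≤ 2 * k) ∣X∣≡m costA) ⟩
      2 * ∣E∣ H * (2 * m)               ≡⟨ rearrange (∣E∣ H) m ⟩
      2 * (2 * m * ∣E∣ H)               ∎)) }
    where
      open ≤-Reasoning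
      rearrange : ∀ e a → 2 * e * (2 * a) ≡ 2 * (2 * a * e)
      rearrange = solve-∀
  -- With at most one vertex `G` has no edge, so any nonconstant colouring of the product cuts
  -- nothing and `l` is 0.
  ≤2λ∣E∣ {m} ((_ , _ , inj₂ n≤1) , _) = *-cancelˡ-≤ 2 (≤-trans (l≤cut (proj₁ some) (proj₂ some))
      (≤-trans (∑∑-mono (λ i j → ≤-reflexive (cong (λ e → ⟦ e ⟧ * cost H (proj₁ some i) (proj₁ some j)) (edgeless i j))))
               (≤-trans (≤-reflexive (trans (sum-cong {n G} (λ _ → sum-0 (n G))) (sum-0 (n G)))) z≤n)))
    where
      subsingleton : ∀ {k} → k ≤ 1 → (i j : Fin k) → i ≡ j
      subsingleton (s≤s z≤n) zero zero = refl
      edgeless : ∀ i j → adj G i j ≡ false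
      edgeless i j = trans (cong (adj G i) (subsingleton n≤1 j i)) (irrefl G i)

  -- Inside `A` the colour is the sum of `c` and `d`, which both flip along a product edge avoiding
  -- `X` and `Y`; outside `A` it is constant. Of the two product edges over an edge of `G` and one
  -- of `H`, both may be cut if an edge lies in `X` or `Y`, and one if the edge of `G` leaves `A`
  -- and that of `H` avoids `Y`.
  ≤ψ : ∀ {r f} → Rho G r → Frustration H f → l ≤ ψ G H r f
  ≤ψ {r} {φ} ((A , (v , Tv) , f , ((X , _ , ∣X∣≡f , c , proper) , _) , r≡) , _)
             ((Y , _ , ∣Y∣≡φ , d , properH) , _) =
      *-cancelˡ-≤ 2 (bound (any? (λ g → any? (λ h → F g h ≟ᵇ false))))
    where
      open ≤-Reasoning
      -- This shift gives the vertex (`v`, `h₀`) the colour true, so one false value makes `F`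
      -- nonconstant.
      s : Bool
      s = c v xor d h₀
      F : Fin (n G) → Fin (n H) → Bool
      F g h = A g ∧ not ((c g xor d h) xor s)
      x z : Fin (n G) → Fin (n G) → ℕ
      x i j = ⟦ S X i j ⟧
      z i j = wt G i j * ⟦ A i xor A j ⟧
      y : Fin (n H) → Fin (n H) → ℕ
      y a b = ⟦ S Y a b ⟧

      -- Restates properness as a Boolean equation, ready for the truth tables `colours` and
      -- `forced`.
      separated : ∀ {p q e t c d} → (T (p ∧ q ∧ e ∧ not t) → c ≢ d) → e ≡ true →
        t ∨ (not (p ∧ q) ∨ (c xor d)) ≡ true
      separated {t = true} _ refl = refl
      separated {false} {t = false} _ refl = refl
      separated {true} {false} {t = false} _ refl = refl
      separated {true} {true} {t = false} {true}  {false} _ refl = refl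
      separated {true} {true} {t = false} {false} {true}  _ refl = refl
      separated {true} {true} {t = false} {true}  {true}  h refl = ⊥-elim (h tt refl)
      separated {true} {true} {t = false} {false} {false} h refl = ⊥-elim (h tt refl)

      -- Each double sum over ordered pairs is twice an edge count, so the products of two such sums
      -- carry a factor 4.
      2ψ : 2 * (∑∑ x * ∑∑ (wt H)) + (∑∑ z * ∑∑ (wt H) + 2 * (∑∑ (wt G) * ∑∑ y)) ≡ 2 * (2 * ψ G H r φ)
      2ψ rewrite ∑∑-edgeSet G X | ∑∑-edgeSet H Y | ∑∑-wt G | ∑∑-wt H | cost-crossEdges G A | ∣X∣≡f | ∣Y∣≡φ | r≡ =
        expand f (crossEdges G A) (∣E∣ H) (∣E∣ G) φ
        where
          expand : ∀ f k e′ e p → 2 * ((2 * f) * (2 * e′)) + ((2 * k) * (2 * e′) + 2 * ((2 * e) * (2 * p)))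
                                ≡ 2 * (2 * ((2 * f + k) * e′ + 2 * p * e))
          expand = solve-∀

      -- Both factors of a product edge are unordered, so the two ways of
      -- pairing up their ends are counted together.
      dominated : ∀ F′ → (∀ i j a b → adj G i j ≡ true → adj H a b ≡ true →
          ⟦ F′ i a xor F′ j b ⟧ + ⟦ F′ i b xor F′ j a ⟧ ≤ 2 * x i j + (⟦ A i xor A j ⟧ + 2 * y a b)) →
        cutSum G H F′ ≤ 2 * ψ G H r φ
      dominated F′ h = *-cancelˡ-≤ 2 (begin
        2 * cutSum G H F′
          ≡⟨ ∑∑-* 2 (λ i j → wt G i j * cost H (F′ i) (F′ j)) ⟨
        ∑∑ (λ i j → 2 * (wt G i j * cost H (F′ i) (F′ j)))
          ≡⟨ ∑∑-cong (λ i j → trans (exchange (wt G i j) _) (trans (cong (wt G i j *_) (≡-sym (cost-double H (F′ i) (F′ j))))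
               (≡-sym (∑∑-* (wt G i j) (λ a b → wt H a b * (⟦ F′ i a xor F′ j b ⟧ + ⟦ F′ i b xor F′ j a ⟧)))))) ⟩
        ∑∑ (λ i j → ∑∑ (λ a b → wt G i j * (wt H a b * (⟦ F′ i a xor F′ j b ⟧ + ⟦ F′ i b xor F′ j a ⟧))))
          ≤⟨ ∑∑-mono (λ i j → ∑∑-mono (λ a b → pointwise i j a b)) ⟩
        ∑∑ (λ i j → ∑∑ (λ a b → 2 * (x i j * wt H a b) + (z i j * wt H a b + 2 * (wt G i j * y a b))))
          ≡⟨ ∑∑-cong (λ i j → trans (∑∑-+ (λ a b → 2 * (x i j * wt H a b)) (λ a b → z i j * wt H a b + 2 * (wt G i j * y a b)))
               (cong₂ _+_ (∑∑-* 2 (λ a b → x i j * wt H a b))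
                 (trans (∑∑-+ (λ a b → z i j * wt H a b) (λ a b → 2 * (wt G i j * y a b)))
                        (cong (X₂ i j +_) (∑∑-* 2 (λ a b → wt G i j * y a b)))))) ⟩
        ∑∑ (λ i j → 2 * X₁ i j + (X₂ i j + 2 * X₃ i j))
          ≡⟨ trans (∑∑-+ (λ i j → 2 * X₁ i j) (λ i j → X₂ i j + 2 * X₃ i j))
               (cong₂ _+_ (∑∑-* 2 X₁) (trans (∑∑-+ X₂ (λ i j → 2 * X₃ i j)) (cong (∑∑ X₂ +_) (∑∑-* 2 X₃)))) ⟩
        2 * ∑∑ X₁ + (∑∑ X₂ + 2 * ∑∑ X₃)
          ≡⟨ cong₂ _+_ (cong (2 *_) (∑∑-product x (wt H)))
               (cong₂ _+_ (∑∑-product z (wt H)) (cong (2 *_) (∑∑-product (wt G) y))) ⟩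
        2 * (∑∑ x * ∑∑ (wt H)) + (∑∑ z * ∑∑ (wt H) + 2 * (∑∑ (wt G) * ∑∑ y))
          ≡⟨ 2ψ ⟩
        2 * (2 * ψ G H r φ) ∎)
        where
          exchange : ∀ a b → 2 * (a * b) ≡ a * (2 * b)
          exchange = solve-∀
          X₁ X₂ X₃ : Fin (n G) → Fin (n G) → ℕ
          X₁ i j = ∑∑ (λ a b → x i j * wt H a b)
          X₂ i j = ∑∑ (λ a b → z i j * wt H a b)
          X₃ i j = ∑∑ (λ a b → wt G i j * y a b)
          units : ∀ x z y → 2 * x + (z + 2 * y) ≡ 2 * (x * 1) + ((1 * z) * 1 + 2 * (1 * y))
          units = solve-∀
          pointwise : ∀ i j a b → wt G i j * (wt H a b * (⟦ F′ i a xor F′ j b ⟧ + ⟦ F′ i b xor F′ j a ⟧))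
            ≤ 2 * (x i j * wt H a b) + (z i j * wt H a b + 2 * (wt G i j * y a b))
          pointwise i j a b with adj G i j in e | adj H a b in e′
          ... | false | _     = z≤n
          ... | true  | false = z≤n
          ... | true  | true  = ≤-trans (≤-reflexive (trans (+-identityʳ _) (+-identityʳ _)))
                  (≤-trans (h i j a b e e′) (≤-reflexive (units (x i j) ⟦ A i xor A j ⟧ (y a b))))

      bound : Dec (∃[ g ] ∃[ h ] F g h ≡ false) → 2 * l ≤ 2 * ψ G H r φ
      bound (yes (g , h , Fgh)) = ≤-trans (l≤cut F (v , h₀ , g , h , Fv , Fgh))
          (dominated F λ i j a b e e′ → colours (S X i j) (S Y a b) (A i) (A j) (c i) (c j) (d a) (d b) s
             (separated {A i} {A j} {adj G i j} (proper i j) e) (separated {true} {true} {adj H a b} (properH a b) e′))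
        where
          Fv : F v h₀ ≡ true
          Fv = cong₂ (λ p q → p ∧ not q) (Equivalence.to T-≡ Tv) (xor-same s)
          colours : ∀ t u A A′ c c′ d d′ s → t ∨ (not (A ∧ A′) ∨ (c xor c′)) ≡ true → u ∨ (d xor d′) ≡ true →
            ⟦ (A ∧ not ((c xor d) xor s)) xor (A′ ∧ not ((c′ xor d′) xor s)) ⟧ +
            ⟦ (A ∧ not ((c xor d′) xor s)) xor (A′ ∧ not ((c′ xor d) xor s)) ⟧
              ≤ 2 * ⟦ t ⟧ + (⟦ A xor A′ ⟧ + 2 * ⟦ u ⟧)
          colours = toWitness {a? = ∀-Bool? λ t → ∀-Bool? λ u → ∀-Bool? λ A → ∀-Bool? λ A′ → ∀-Bool? λ c → ∀-Bool? λ c′ →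
            ∀-Bool? λ d → ∀-Bool? λ d′ → ∀-Bool? λ s → (_ ≟ᵇ _) →-dec ((_ ≟ᵇ _) →-dec (_ ≤? _))} tt
      -- If F is constant then every edge of G is in X, so ψ is at least the
      -- number of edges of the product and any other colouring will do.
      bound (no none) = ≤-trans (l≤cut (proj₁ some) (proj₂ some))
          (dominated (proj₁ some) λ i j a b e e′ →
            ≤-trans (at-most-two (proj₁ some i a xor proj₁ some j b) (proj₁ some i b xor proj₁ some j a)) (≤-trans (≤-reflexive (cong (λ t → 2 * ⟦ t ⟧) (≡-sym (deleted i j e)))) (m≤m+n _ _)))
        where
          at-most-two : ∀ p q → ⟦ p ⟧ + ⟦ q ⟧ ≤ 2
          at-most-two = toWitness {a? = ∀-Bool? λ p → ∀-Bool? λ q → _ ≤? _} tt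
          full : ∀ g h → F g h ≡ true
          full g h with F g h in eq
          ... | true  = refl
          ... | false = ⊥-elim (none (g , h , eq))
          forced : ∀ t A A′ c c′ d s → t ∨ (not (A ∧ A′) ∨ (c xor c′)) ≡ true →
            A ∧ not ((c xor d) xor s) ≡ true → A′ ∧ not ((c′ xor d) xor s) ≡ true → t ≡ true
          forced = toWitness {a? = ∀-Bool? λ t → ∀-Bool? λ A → ∀-Bool? λ A′ → ∀-Bool? λ c → ∀-Bool? λ c′ →
            ∀-Bool? λ d → ∀-Bool? λ s → (_ ≟ᵇ _) →-dec ((_ ≟ᵇ _) →-dec ((_ ≟ᵇ _) →-dec (_ ≟ᵇ _)))} tt
          deleted : ∀ i j → adj G i j ≡ true → S X i j ≡ true
          deleted i j e = forced (S X i j) (A i) (A j) (c i) (c j) (d h₀) s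
            (separated {A i} {A j} {adj G i j} (proper i j) e) (full i h₀) (full j h₀)

-- Assembling the equality.

other-element : ∀ {k} → ¬ (k ≤ 1) → (v : Fin k) → ∃[ u ] u ≢ v
other-element {suc zero}    k≰1 v       = ⊥-elim (k≰1 ≤-refl)
other-element {suc (suc k)} k≰1 zero    = suc zero , λ ()
other-element {suc (suc k)} k≰1 (suc v) = zero , λ ()

positive-factors : ∀ a b → 1 ≤ a * b → 1 ≤ a × 1 ≤ b
positive-factors (suc a) (suc b) _ = s≤s z≤n , s≤s z≤n
positive-factors (suc a) zero    p = ⊥-elim (contradiction (subst (1 ≤_) (*-zeroʳ a) p) λ ())

theorem1p1 : (G H : Graph) → 1 ≤ n G → 1 ≤ n H →
    (λG λH λGH δGH ρG ρH φG φH : ℕ) →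
    EdgeConnectivity G λG → EdgeConnectivity H λH →
    EdgeConnectivity (G ×ᵍ H) λGH → MinDegree (G ×ᵍ H) δGH →
    Rho G ρG → Rho H ρH → Frustration G φG → Frustration H φH →
    λGH ≡ (2 * λG * ∣E∣ H) ⊓ (2 * λH * ∣E∣ G) ⊓ δGH
    ⊓ ψ G H ρG φH ⊓ ψ H G ρH φG
theorem1p1 G H _ 1≤nH λG λH λGH δGH ρG ρH φG φH
           connG connH connK ((v , degv≡δ) , δ-min) rhoG rhoH frG frH =
  ≤-antisym upper lower
  where
    open ≤-Reasoning
    K : Graph
    K = G ×ᵍ H
    g : Fin (n G)
    g = fstV G H v
    h : Fin (n H)
    h = sndV G H v
    d d′ RHS : ℕ
    -- Degrees of the coordinates of a vertex of minimum degree in the product. In the positive case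
    -- they turn out to be the minimum degrees of the factors.
    d = deg G g
    d′ = deg H h
    RHS = (2 * λG * ∣E∣ H) ⊓ (2 * λH * ∣E∣ G) ⊓ δGH ⊓ ψ G H ρG φH ⊓ ψ H G ρH φG

    at-pair : ∀ p → combine (fstV G H p) (sndV G H p) ≡ p
    at-pair = combine-remQuot {n G} (n H)

    δ≡dd′ : δGH ≡ d * d′
    δ≡dd′ = trans (≡-sym degv≡δ) (deg-product G H v)

    nK≤1⇒λ≡0 : n K ≤ 1 → λGH ≡ 0
    nK≤1⇒λ≡0 = λ-trivial K connK

    upper : λGH ≤ RHS
    upper with n K ≤? 1
    -- A product with at most one vertex has no nonconstant colouring; here the convention gives
    -- connectivity 0.
    ... | yes nK≤1 = subst (_≤ RHS) (≡-sym (nK≤1⇒λ≡0 nK≤1)) z≤n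
    ... | no nK≰1 = ⊓-glb (⊓-glb (⊓-glb (⊓-glb
          (≤2λ∣E∣ G H λ≤cut some h connG)
          (≤2λ∣E∣ H G λ≤cut-flip some-flip g connH))
          (subst (λGH ≤_) degv≡δ (λ≤deg K connK (proj₂ other))))
          (≤ψ G H λ≤cut some h rhoG frH))
          (≤ψ H G λ≤cut-flip some-flip g rhoH frG)
      where
        λ≤cut : ∀ F → IsNonconstant F → 2 * λGH ≤ cutSum G H F
        λ≤cut F (i , a , j , b , Ft , Ff) = subst (2 * λGH ≤_) (cost-product G H A F (λ _ → refl))
            (λ≤cost K connK A {combine i a} {combine j b} (trans (at i a) Ft) (trans (at j b) Ff))
          where
            A : Fin (n K) → Bool
            A p = F (fstV G H p) (sndV G H p)
            at : ∀ i a → A (combine i a) ≡ F i a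
            at i a = cong (λ { (x , y) → F x y }) (remQuot-combine i a)
        λ≤cut-flip : ∀ F → IsNonconstant F → 2 * λGH ≤ cutSum H G F
        λ≤cut-flip F (a , i , b , j , Ft , Ff) = subst (2 * λGH ≤_) (cutSum-flip G H (flip F))
          (λ≤cut (flip F) (i , a , j , b , Ft , Ff))
        other : ∃[ u ] u ≢ v
        other = other-element nK≰1 v
        u : Fin (n K)
        u = proj₁ other
        F₀ : Fin (n G) → Fin (n H) → Bool
        F₀ i a = does (combine i a ≟ꟳ v)
        some : Σ[ F ∈ (Fin (n G) → Fin (n H) → Bool) ] IsNonconstant F
        some = F₀ , g , h , fstV G H u , sndV G H u ,
          dec-true (combine g h ≟ꟳ v) (at-pair v) ,
          dec-false (combine (fstV G H u) (sndV G H u) ≟ꟳ v) (λ e → proj₂ other (trans (≡-sym (at-pair u)) e))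
        some-flip : Σ[ F ∈ (Fin (n H) → Fin (n G) → Bool) ] IsNonconstant F
        some-flip = flip F₀ , h , g , sndV G H u , fstV G H u , proj₂ (proj₂ (proj₂ (proj₂ (proj₂ some))))

    -- Positivity of the minimum forces both connectivities and both degrees to be positive, as the
    -- cut bounds require; if the minimum is 0 the inequality is trivial.
    module Positive (1≤RHS : 1 ≤ RHS) where

      1≤δ : 1 ≤ d * d′
      1≤δ = subst (1 ≤_) δ≡dd′ (≤-trans 1≤RHS
        (≤-trans (m⊓n≤m _ (ψ H G ρH φG)) (≤-trans (m⊓n≤m _ (ψ G H ρG φH)) (m⊓n≤n _ δGH))))
      1≤d : 1 ≤ d
      1≤d = proj₁ (positive-factors d d′ 1≤δ)
      1≤d′ : 1 ≤ d′
      1≤d′ = proj₂ (positive-factors d d′ 1≤δ)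

      1≤⊓ : 1 ≤ (2 * λG * ∣E∣ H) ⊓ (2 * λH * ∣E∣ G)
      1≤⊓ = ≤-trans 1≤RHS
        (≤-trans (m⊓n≤m _ (ψ H G ρH φG)) (≤-trans (m⊓n≤m _ (ψ G H ρG φH)) (m⊓n≤m _ δGH)))
      1≤λG : 1 ≤ λG
      1≤λG = proj₂ (positive-factors 2 λG (proj₁ (positive-factors (2 * λG) (∣E∣ H)
               (≤-trans 1≤⊓ (m⊓n≤m _ (2 * λH * ∣E∣ G))))))
      1≤λH : 1 ≤ λH
      1≤λH = proj₂ (positive-factors 2 λH (proj₁ (positive-factors (2 * λH) (∣E∣ G)
               (≤-trans 1≤⊓ (m⊓n≤n (2 * λG * ∣E∣ H) _)))))

      dd′≤deg : ∀ i a → d * d′ ≤ deg G i * deg H a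
      dd′≤deg i a = begin
        d * d′                        ≡⟨ δ≡dd′ ⟨
        δGH                           ≤⟨ δ-min _ (combine i a , refl) ⟩
        deg K (combine i a)           ≡⟨ deg-product G H (combine i a) ⟩
        deg G (fstV G H (combine i a)) * deg H (sndV G H (combine i a))
                                      ≡⟨ cong (λ { (x , y) → deg G x * deg H y }) (remQuot-combine i a) ⟩
        deg G i * deg H a             ∎
      -- Moving only the first coordinate and cancelling the fixed factor `d′` isolates the degree
      -- in `G`.
      d≤deg : ∀ i → d ≤ deg G i
      d≤deg i = *-cancelʳ-≤ d (deg G i) d′ {{>-nonZero 1≤d′}} (dd′≤deg i h)
      d′≤deg : ∀ a → d′ ≤ deg H a
      d′≤deg a = *-cancelˡ-≤ d {{>-nonZero 1≤d}} (dd′≤deg g a)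

      2RHS≤cut : ∀ F → IsNonconstant F → 2 * RHS ≤ cutSum G H F
      2RHS≤cut F (i , a , j , b , Ft , Ff) = subst
        (λ δ → 2 * ((2 * λG * ∣E∣ H) ⊓ (2 * λH * ∣E∣ G) ⊓ δ ⊓ ψ G H ρG φH ⊓ ψ H G ρH φG) ≤ cutSum G H F)
        (≡-sym δ≡dd′)
        (cut-lower-bound G H connG connH rhoG rhoH frG frH d≤deg d′≤deg 1≤λG 1≤λH 1≤d 1≤d′ F Ft Ff)

      from-disconnecting : ∀ (X : EdgeSet K) → (¬ Connected (K ∖ₑ X)) ⊎ n K ≤ 1 → RHS ≤ ∣ X ∣ₑ
      from-disconnecting X (inj₁ disc) = decidable-stable (RHS ≤? ∣ X ∣ₑ) λ RHS≰ →
        disconnected⇒cut K X disc λ { (A , p , q , Ap , Aq , le) → RHS≰ (*-cancelˡ-≤ 2 (begin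
          2 * RHS                                ≤⟨ 2RHS≤cut (λ i a → A (combine i a))
                                                     ( fstV G H p , sndV G H p , fstV G H q , sndV G H q
                                                     , trans (cong A (at-pair p)) Ap , trans (cong A (at-pair q)) Aq) ⟩
          cutSum G H (λ i a → A (combine i a))   ≡⟨ cost-product G H A (λ i a → A (combine i a)) (λ p → cong A (≡-sym (at-pair p))) ⟨
          cost K A A                             ≤⟨ le ⟩
          2 * ∣ X ∣ₑ                             ∎)) }
      -- A product with at most one vertex forces `G` to have at most one too, since `H` is
      -- nonempty; then λ(G) = 0 contradicts positivity.
      from-disconnecting X (inj₂ nK≤1) = contradiction
        (subst (1 ≤_) (λ-trivial G connG (≤-trans (m≤m*n (n G) (n H) {{>-nonZero 1≤nH}}) nK≤1)) 1≤λG) λ ()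

    lower : RHS ≤ λGH
    lower with 1 ≤? RHS
    ... | no RHS≱1 = ≤-trans (≤-pred (≰⇒> RHS≱1)) z≤n
    ... | yes 1≤RHS with proj₁ connK
    ...   | X , ∣X∣≡ , disc = subst (RHS ≤_) ∣X∣≡ (Positive.from-disconnecting 1≤RHS X disc)
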